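{- Let $f(x)\in\mathbf{Z}[x]$ be a nonconstant separable polynomial and let $p$ be a good prime for $f(x)$. (1) If $f(x)$ has odd degree, then there are infinitely many $d\in\mathcal{S}(f)$ such that $p\mid d$. (2) Suppose $f(x)$ has even degree. (a) If there exists $d\in\mathcal{S}(f)$ such that $p\mid d$, then $f(x)$ has a root modulo $p$. (b) Conversely, if $f(x)$ has a root modulo $p$, then there are infinitely many $d\in\mathcal{S}(f)$ such that $p\mid d$.
   Context: Squarefree integers may be negative and are nonzero. For a nonzero rational number $r$, its squarefree part $S(r)$ is the unique squarefree integer $d$ such that $r/d$ is a square in $\mathbf{Q}$. For a separable nonconstant $f(x)\in\mathbf{Z}[x]$, $\mathcal{S}(f)=\{S(f(r)) : r\in\mathbf{Q},\ f(r)\neq 0\}$. An odd prime $p$ is good for $f(x)$ if the reduced polynomial $\bar f(x)\in\mathbf{F}_p[x]$ has the same degree as $f(x)$ and has nonzero discriminant. -}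

module Defs where

open import Algebra.Bundles using (CommutativeRing; Monoid; Semiring)
import Algebra.Definitions.RawMonoid
import Algebra.Definitions.RawSemiring
import Algebra.Properties.CommutativeSemigroup
import Algebra.Properties.Semiring.Sum
open import Data.Fin.Base using (Fin; zero; suc; toℕ; splitAt; opposite; punchIn)
open import Data.Fin.Properties using (opposite-prop)
open import Data.Integer.Base as ℤ using (ℤ; +_; 0ℤ; ∣_∣)
open import Data.Integer.Divisibility.Signed as ℤ∣ using (_∣_)
import Data.Integer.Properties as ℤₚ
import Data.Integer.Tactic.RingSolver as ℤ-Solver
open import Data.List.Base using (List; []; _∷_; map; foldr; replicate; _++_)
open import Data.List.Membership.Propositional using (_∉_)
open import Data.Nat.Base as ℕ using (ℕ; zero; suc; pred; _∸_; _/_; _≤_; _<_; z≤n; s≤s)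
open import Data.Nat.Primality using (Prime)
import Data.Nat.Properties as ℕₚ
open import Data.Product.Base using (_×_; _,_; ∃-syntax)
open import Data.Rational.Base as ℚ using (ℚ; 0ℚ)
open import Data.Rational.Literals using (fromℤ)
import Data.Rational.Properties as ℚₚ
open import Data.Sum.Base using ([_,_]′; inj₁; inj₂)
open import Level using (Level; _⊔_; 0ℓ)
open import Relation.Binary.PropositionalEquality as ≡ using (_≡_; _≢_)
import Relation.Binary.Reasoning.Setoid
open import Relation.Nullary.Negation using (¬_; contradiction)

module Polynomials {c ℓ : Level} (R : CommutativeRing c ℓ) where

  open CommutativeRing R hiding (zero)
  open Algebra.Definitions.RawMonoid (Monoid.rawMonoid +-monoid) using (sum) renaming (_×_ to _·_)
  open Algebra.Definitions.RawSemiring (Semiring.rawSemiring semiring) using (_^_)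

  infix  4 _≈ₚ_
  infixl 6 _+ₚ_
  infixl 7 _*ₚ_

  -- Coefficient lists, constant term first.  Trailing zeros are allowed, so
  -- the degree is not determined by the length of the list.
  Poly : Set c
  Poly = List Carrier

  coeff : Poly → ℕ → Carrier
  coeff []      _       = 0#
  coeff (a ∷ f) zero    = a
  coeff (a ∷ f) (suc k) = coeff f k

  _≈ₚ_ : Poly → Poly → Set ℓ
  f ≈ₚ g = ∀ k → coeff f k ≈ coeff g k

  eval : Poly → Carrier → Carrier
  eval f x = foldr (λ a y → a + x * y) 0# f

  1ₚ : Poly
  1ₚ = 1# ∷ []

  _+ₚ_ : Poly → Poly → Poly
  []      +ₚ g       = g
  f       +ₚ []      = f
  (a ∷ f) +ₚ (b ∷ g) = a + b ∷ f +ₚ g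

  _*ₚ_ : Poly → Poly → Poly
  []      *ₚ g = []
  (a ∷ f) *ₚ g = map (a *_) g +ₚ (0# ∷ f *ₚ g)

  -- X^[ k ]* f is the polynomial xᵏ f.
  X^[_]*_ : ℕ → Poly → Poly
  X^[ k ]* f = replicate k 0# ++ f

  -- weighted k (a₀ ∷ a₁ ∷ …) = k a₀ ∷ (k + 1) a₁ ∷ …
  weighted : ℕ → Poly → Poly
  weighted k []      = []
  weighted k (a ∷ f) = k · a ∷ weighted (suc k) f

  derivative : Poly → Poly
  derivative []      = []
  derivative (_ ∷ f) = weighted 1 f

  HasDegree : Poly → ℕ → Set ℓ
  HasDegree f n = ¬ (coeff f n ≈ 0#) × (∀ k → n < k → coeff f k ≈ 0#)

  CoprimeToDerivative : Poly → Set (c ⊔ ℓ)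
  CoprimeToDerivative f = ∃[ u ] ∃[ v ] (u *ₚ f +ₚ v *ₚ derivative f ≈ₚ 1ₚ)

  Matrix : ℕ → Set c
  Matrix n = Fin n → Fin n → Carrier

  -- Row 0 and column j deleted.
  minor : ∀ {n} → Matrix (suc n) → Fin (suc n) → Matrix n
  minor M j i k = M (suc i) (punchIn j k)

  -- Laplace expansion along the first row.
  det : ∀ {n} → Matrix n → Carrier
  det {zero}  M = 1#
  det {suc n} M = sum λ j → (- 1#) ^ toℕ j * (M zero j * det (minor M j))

  -- f has formal degree m and g has formal degree n.  The rows are
  -- xⁿ⁻¹f, …, xf, f, xᵐ⁻¹g, …, xg, g and the columns are the coefficients of
  -- xᵐ⁺ⁿ⁻¹, …, x, 1.
  sylvester : ∀ m n → Poly → Poly → Matrix (n ℕ.+ m)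
  sylvester m n f g i j =
    [ (λ a → coeff (X^[ toℕ (opposite a) ]* f) (toℕ (opposite j)))
    , (λ b → coeff (X^[ toℕ (opposite b) ]* g) (toℕ (opposite j)))
    ]′ (splitAt n i)

  resultant : (m n : ℕ) → Poly → Poly → Carrier
  resultant m n f g = det (sylvester m n f g)

  -- The Sylvester matrix of f and f′ with its first column divided by the
  -- leading coefficient aₙ.  That column has only the entries aₙ (from f) and
  -- n aₙ (from f′), so after division it is the first column of the Sylvester
  -- matrix of xⁿ and its derivative.
  discriminantMatrix : ∀ n → Poly → Matrix (pred n ℕ.+ n)
  discriminantMatrix n f i j with toℕ j
  ... | zero  = sylvester n (pred n) (X^[ n ]* 1ₚ) (derivative (X^[ n ]* 1ₚ)) i j
  ... | suc _ = sylvester n (pred n) f (derivative f) i j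

  discriminantSign : ℕ → Carrier
  discriminantSign n = (- 1#) ^ (n ℕ.* pred n / 2)

  -- (-1)^(n(n-1)/2) aₙ⁻¹ Res(f, f′) for f of degree n ≥ 1, with the division
  -- carried out inside the determinant so that it makes sense over any ring;
  -- see leading*discriminant below.
  discriminant : ℕ → Poly → Carrier
  discriminant n f = discriminantSign n * det (discriminantMatrix n f)

  private
    module +-Sum = Algebra.Properties.Semiring.Sum semiring
    open Algebra.Properties.CommutativeSemigroup *-commutativeSemigroup
      using (x∙yz≈y∙xz)

  module Auxiliary where
    open Relation.Binary.Reasoning.Setoid setoid
    open import Algebra.Properties.Monoid.Mult +-monoid using (×-congʳ)
    open import Algebra.Properties.Semiring.Mult semiring using (×-comm-*)

    det-cong : ∀ {n} (A B : Matrix n) → (∀ i j → A i j ≈ B i j) → det A ≈ det B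
    det-cong {zero}  A B e = refl
    det-cong {suc n} A B e = +-Sum.sum-cong-≋ λ j → *-congˡ {x = (- 1#) ^ toℕ j}
      (*-cong (e zero j) (det-cong (minor A j) (minor B j) λ i k → e (suc i) (punchIn j k)))

    det-scale : ∀ {n} a (A B : Matrix (suc n)) →
                (∀ i → A i zero ≈ a * B i zero) →
                (∀ i j → A i (suc j) ≈ B i (suc j)) →
                det A ≈ a * det B
    det-scale {n} a A B e₀ e₁ = begin
      sum (term A)              ≈⟨ +-Sum.sum-cong-≋ step ⟩
      sum (λ j → a * term B j)  ≈⟨ +-Sum.*-distribˡ-sum a (term B) ⟨
      a * sum (term B)          ∎
      where
      term : Matrix (suc n) → Fin (suc n) → Carrier
      term M j = (- 1#) ^ toℕ j * (M zero j * det (minor M j))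

      entries : ∀ j → A zero j * det (minor A j) ≈ a * (B zero j * det (minor B j))
      entries zero = trans
        (*-cong (e₀ zero) (det-cong (minor A zero) (minor B zero) λ i k → e₁ (suc i) k))
        (*-assoc a _ _)
      entries (suc {suc _} j) = trans
        (*-cong (e₁ zero j)
          (det-scale a (minor A (suc j)) (minor B (suc j))
            (λ i → e₀ (suc i)) (λ i k → e₁ (suc i) (punchIn j k))))
        (x∙yz≈y∙xz _ a _)

      step : ∀ j → term A j ≈ a * term B j
      step j = trans (*-congˡ (entries j)) (x∙yz≈y∙xz _ a _)

    Scaled : Carrier → ℕ → Poly → Poly → Set ℓ
    Scaled a n f g = ∀ k → n ≤ k → coeff f k ≈ a * coeff g k

    scaled-shift : ∀ {a n f g} → Scaled a n f g → ∀ s K → s ℕ.+ n ≤ K →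
                   coeff (X^[ s ]* f) K ≈ a * coeff (X^[ s ]* g) K
    scaled-shift e zero    K       le       = e K le
    scaled-shift e (suc s) (suc K) (s≤s le) = scaled-shift e s K le

    coeff-X^ : ∀ n → coeff (X^[ n ]* 1ₚ) n ≈ 1#
    coeff-X^ zero    = refl
    coeff-X^ (suc n) = coeff-X^ n

    coeff-X^-> : ∀ n k → n < k → coeff (X^[ n ]* 1ₚ) k ≈ 0#
    coeff-X^-> zero    (suc k) _        = refl
    coeff-X^-> (suc n) (suc k) (s≤s lt) = coeff-X^-> n k lt

    scaled-X^ : ∀ {f n} → HasDegree f n → Scaled (coeff f n) n f (X^[ n ]* 1ₚ)
    scaled-X^ {f} {n} (_ , top) k n≤k with ℕₚ.m≤n⇒m<n∨m≡n n≤k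
    ... | inj₁ n<k    = trans (top k n<k)
                          (sym (trans (*-congˡ (coeff-X^-> n k n<k)) (zeroʳ _)))
    ... | inj₂ ≡.refl = sym (trans (*-congˡ (coeff-X^ n)) (*-identityʳ _))

    ·-zero : ∀ n → n · 0# ≈ 0#
    ·-zero zero    = refl
    ·-zero (suc n) = trans (+-identityˡ _) (·-zero n)

    coeff-weighted : ∀ w f k → coeff (weighted w f) k ≈ (w ℕ.+ k) · coeff f k
    coeff-weighted w []      k       = sym (·-zero (w ℕ.+ k))
    coeff-weighted w (a ∷ f) zero    rewrite ℕₚ.+-identityʳ w = refl
    coeff-weighted w (a ∷ f) (suc k) rewrite ℕₚ.+-suc w k = coeff-weighted (suc w) f k

    coeff-derivative : ∀ f k → coeff (derivative f) k ≈ suc k · coeff f (suc k)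
    coeff-derivative []      k = sym (·-zero (suc k))
    coeff-derivative (_ ∷ f) k = coeff-weighted 1 f k

    scaled-derivative : ∀ {a n f g} → Scaled a (suc n) f g →
                        Scaled a n (derivative f) (derivative g)
    scaled-derivative {a} {n} {f} {g} e k n≤k = begin
      coeff (derivative f) k           ≈⟨ coeff-derivative f k ⟩
      suc k · coeff f (suc k)          ≈⟨ ×-congʳ (suc k) (e (suc k) (s≤s n≤k)) ⟩
      suc k · (a * coeff g (suc k))    ≈⟨ ×-comm-* (suc k) a _ ⟨
      a * (suc k · coeff g (suc k))    ≈⟨ *-congˡ (coeff-derivative g k) ⟨
      a * coeff (derivative g) k       ∎

    opposite-≤ : ∀ {n} (i : Fin (suc n)) → toℕ (opposite i) ≤ n
    opposite-≤ {n} i = ≡.subst (_≤ n) (≡.sym (opposite-prop i)) (ℕₚ.m∸n≤m n (toℕ i))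

    first-column : ∀ {a f g} m (i : Fin (m ℕ.+ suc m)) j → toℕ j ≡ 0 →
                   Scaled a (suc m) f g →
                   sylvester (suc m) m f (derivative f) i j ≈
                   a * sylvester (suc m) m g (derivative g) i j
    first-column {a} {f} {g} m i j j≡0 e with splitAt m i
    ... | inj₁ s = scaled-shift e (toℕ (opposite s)) _ (bound m s j j≡0)
      where
      bound : ∀ m (s : Fin m) (j : Fin (m ℕ.+ suc m)) → toℕ j ≡ 0 →
              toℕ (opposite s) ℕ.+ suc m ≤ toℕ (opposite j)
      bound (suc m) s j j≡0 rewrite opposite-prop j | j≡0 =
        ℕₚ.+-monoˡ-≤ (suc (suc m)) (opposite-≤ s)
    ... | inj₂ s = scaled-shift (scaled-derivative {f = f} {g} e) (toℕ (opposite s)) _ bound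
      where
      bound : toℕ (opposite s) ℕ.+ m ≤ toℕ (opposite j)
      bound rewrite opposite-prop j | j≡0 | ℕₚ.+-suc m m =
        ℕₚ.+-monoˡ-≤ m (opposite-≤ s)

    det-scale′ : ∀ {N} a (A B : Matrix N) → 1 ≤ N →
                 (∀ i j → toℕ j ≡ 0 → A i j ≈ a * B i j) →
                 (∀ i j → toℕ j ≢ 0 → A i j ≈ B i j) →
                 det A ≈ a * det B
    det-scale′ {suc N} a A B _ e₀ e₁ =
      det-scale a A B (λ i → e₀ i zero ≡.refl) (λ i j → e₁ i (suc j) λ ())

    resultant-discriminant : ∀ f n → 1 ≤ n → HasDegree f n →
      resultant n (pred n) f (derivative f) ≈
      coeff f n * det (discriminantMatrix n f)
    resultant-discriminant f (suc m) _ deg =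
      det-scale′ (coeff f (suc m))
        (sylvester (suc m) m f (derivative f)) (discriminantMatrix (suc m) f)
        (ℕₚ.≤-trans (s≤s z≤n) (ℕₚ.m≤n+m (suc m) m))
        first others
      where
      first : ∀ i j → toℕ j ≡ 0 →
              sylvester (suc m) m f (derivative f) i j ≈
              coeff f (suc m) * discriminantMatrix (suc m) f i j
      first i j j≡0 with toℕ j in eq
      ... | zero = first-column m i j eq (scaled-X^ {f} deg)
      others : ∀ i j → toℕ j ≢ 0 →
               sylvester (suc m) m f (derivative f) i j ≈
               discriminantMatrix (suc m) f i j
      others i j j≢0 with toℕ j
      ... | zero  = contradiction ≡.refl j≢0
      ... | suc _ = refl

  leading*discriminant : ∀ f n → 1 ≤ n → HasDegree f n →
    coeff f n * discriminant n f ≈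
    discriminantSign n * resultant n (pred n) f (derivative f)
  leading*discriminant f n 1≤n deg =
    trans (x∙yz≈y∙xz (coeff f n) (discriminantSign n) _)
          (*-congˡ (sym (Auxiliary.resultant-discriminant f n 1≤n deg)))

infix 4 _≡_[mod_]

_≡_[mod_] : ℤ → ℤ → ℕ → Set
a ≡ b [mod m ] = + m ∣ a ℤ.- b

-- The residue ring: the carrier is ℤ and its setoid equality is congruence.
ℤ/ : ℕ → CommutativeRing 0ℓ 0ℓ
ℤ/ m = record
  { Carrier = ℤ
  ; _≈_     = _≡_[mod m ]
  ; _+_     = ℤ._+_
  ; _*_     = ℤ._*_
  ; -_      = ℤ.-_
  ; 0#      = 0ℤ
  ; 1#      = ℤ.1ℤ
  ; isCommutativeRing = record
    { isRing = record
      { +-isAbelianGroup = record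
        { isGroup = record
          { isMonoid = record
            { isSemigroup = record
              { isMagma = record
                { isEquivalence = record
                  { refl  = λ {a} → reflexive {a} ≡.refl
                  ; sym   = λ {a} {b} a≡b →
                      ≡.subst (+ m ∣_) (sym-eq a b) (ℤ∣.∣m⇒∣-m a≡b)
                  ; trans = λ {a} {b} {c} a≡b b≡c →
                      ≡.subst (+ m ∣_) (trans-eq a b c) (ℤ∣.∣m∣n⇒∣m+n a≡b b≡c)
                  }
                ; ∙-cong = λ {a} {b} {c} {d} a≡b c≡d →
                    ≡.subst (+ m ∣_) (+-eq a b c d) (ℤ∣.∣m∣n⇒∣m+n a≡b c≡d)
                }
              ; assoc = λ a b c → reflexive (ℤₚ.+-assoc a b c)
              }
            ; identity = (λ a → reflexive (ℤₚ.+-identityˡ a))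
                       , (λ a → reflexive (ℤₚ.+-identityʳ a))
            }
          ; inverse = (λ a → reflexive (ℤₚ.+-inverseˡ a))
                    , (λ a → reflexive (ℤₚ.+-inverseʳ a))
          ; ⁻¹-cong = λ {a} {b} a≡b →
              ≡.subst (+ m ∣_) (neg-eq a b) (ℤ∣.∣m⇒∣-m a≡b)
          }
        ; comm = λ a b → reflexive (ℤₚ.+-comm a b)
        }
      ; *-cong = λ {a} {b} {c} {d} a≡b c≡d →
          ≡.subst (+ m ∣_) (*-eq a b c d)
            (ℤ∣.∣m∣n⇒∣m+n (ℤ∣.∣m⇒∣m*n c a≡b) (ℤ∣.∣n⇒∣m*n b c≡d))
      ; *-assoc    = λ a b c → reflexive (ℤₚ.*-assoc a b c)
      ; *-identity = (λ a → reflexive (ℤₚ.*-identityˡ a))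
                   , (λ a → reflexive (ℤₚ.*-identityʳ a))
      ; distrib    = (λ a b c → reflexive (ℤₚ.*-distribˡ-+ a b c))
                   , (λ a b c → reflexive (ℤₚ.*-distribʳ-+ a b c))
      }
    ; *-comm = λ a b → reflexive (ℤₚ.*-comm a b)
    }
  }
  where
  reflexive : ∀ {a b} → a ≡ b → a ≡ b [mod m ]
  reflexive a≡b = ≡.subst (+ m ∣_) (≡.sym (ℤₚ.i≡j⇒i-j≡0 a≡b)) (ℤ∣.divides 0ℤ (≡.sym (ℤₚ.*-zeroˡ (+ m))))

  sym-eq : ∀ a b → ℤ.- (a ℤ.- b) ≡ b ℤ.- a
  sym-eq = ℤ-Solver.solve-∀

  trans-eq : ∀ a b c → (a ℤ.- b) ℤ.+ (b ℤ.- c) ≡ a ℤ.- c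
  trans-eq = ℤ-Solver.solve-∀

  +-eq : ∀ a b c d → (a ℤ.- b) ℤ.+ (c ℤ.- d) ≡ (a ℤ.+ c) ℤ.- (b ℤ.+ d)
  +-eq = ℤ-Solver.solve-∀

  neg-eq : ∀ a b → ℤ.- (a ℤ.- b) ≡ (ℤ.- a) ℤ.- (ℤ.- b)
  neg-eq = ℤ-Solver.solve-∀

  *-eq : ∀ a b c d →
         (a ℤ.- b) ℤ.* c ℤ.+ b ℤ.* (c ℤ.- d) ≡ (a ℤ.* c) ℤ.- (b ℤ.* d)
  *-eq = ℤ-Solver.solve-∀

module ℤ[x] = Polynomials ℤₚ.+-*-commutativeRing
module ℚ[x] = Polynomials ℚₚ.+-*-commutativeRing
module ModularPoly (m : ℕ) = Polynomials (ℤ/ m)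

toℚ[x] : ℤ[x].Poly → ℚ[x].Poly
toℚ[x] = map fromℤ

-- No common root of f and f′ in any extension of ℚ, i.e. f and f′ generate
-- the unit ideal of ℚ[x].
Separable : ℤ[x].Poly → Set
Separable f = ℚ[x].CoprimeToDerivative (toℚ[x] f)

-- Reduction modulo p keeps the coefficient list and only changes the
-- equality of the coefficients.
reduce : ∀ p → ℤ[x].Poly → ModularPoly.Poly p
reduce p f = f

record Good (p : ℕ) (f : ℤ[x].Poly) : Set where
  open ModularPoly p
  field
    prime          : Prime p
    odd            : p ≢ 2
    degree         : ℕ
    hasDegree      : ℤ[x].HasDegree f degree
    reduced-degree : HasDegree (reduce p f) degree
    discriminant≢0 : ¬ (discriminant degree (reduce p f) ≡ 0ℤ [mod p ])

HasRootMod : ℕ → ℤ[x].Poly → Set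
HasRootMod p f = ∃[ a ] (ModularPoly.eval p (reduce p f) a ≡ 0ℤ [mod p ])

-- Excludes 0, by taking k = 2; both signs are allowed.
Squarefree : ℤ → Set
Squarefree d = ∀ k → k ℤ.* k ∣ d → ∣ k ∣ ≡ 1

IsSquare : ℚ → Set
IsSquare q = ∃[ s ] q ≡ s ℚ.* s

-- The graph of r ↦ S(r) on nonzero rationals: d = S(r).
record IsSquarefreePart (r : ℚ) (d : ℤ) : Set where
  field
    {{nonZero}} : ℤ.NonZero d
    squarefree  : Squarefree d
    quotient    : IsSquare (r ℚ.÷ fromℤ d)

𝒮 : ℤ[x].Poly → ℤ → Set
𝒮 f d = ∃[ r ] (f[ r ] ≢ 0ℚ × IsSquarefreePart f[ r ] d)
  where
  f[_] : ℚ → ℚ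
  f[ r ] = ℚ[x].eval (toℚ[x] f) r

-- Constructive form of “P is not finite”: no finite list exhausts P.
Infinite : (ℤ → Set) → Set
Infinite P = ∀ (xs : List ℤ) → ∃[ d ] (P d × d ∉ xs)

{-# OPTIONS --safe #-}

-- Let p ∥ N mean p ∣ N and p² ∤ N.  If f(r) w² = N for integers w ≠ 0 and N,
-- every prime p ∥ N divides S(f(r)).  So for infinitely many multiples of p in
-- 𝒮(f) it suffices to find, for every B ≠ 0, such an N with p ∥ N and q ∥ N for
-- a prime q ∤ B: then S(f(r)) is divisible by p and avoids any finite set whose
-- nonzero members divide B.
--
-- Odd degree n: for a prime q prime to p, B and the leading coefficient take
-- r = 1/(pq); then (pq)ⁿ f(r) is prime to pq, so N = (pq)ⁿ⁺¹ f(r) works.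
--
-- Even degree with a root modulo p: a double root modulo p would annihilate the
-- discriminant, so the root is simple and lifts to an integer a with
-- p ∥ c = f(a).  Along y = a + p² c B D t one has f(y) = c (1 + p B D(…)), where
-- D = u f + v f′ in ℤ[x], up to denominators.  As f(y) ≠ c for large t, the
-- second factor has a prime divisor q ∤ p B D.  Then q ∤ f′(y), and moving y by
-- a multiple of p² q gives q ∥ f(r) while keeping p ∥ f(r).
--
-- Conversely, if f(a/b) = d s² with n even, then F w² = d u² for F = bⁿ f(a/b)
-- and coprime u, w.  As d is squarefree, p ∣ d forces p ∣ F, so p ∤ b and a/b is
-- a root modulo p.

module Submission where

open import Defs
open import Algebra.Bundles using (CommutativeRing; Monoid; Semiring)
import Algebra.Definitions.RawMonoid
import Algebra.Definitions.RawSemiring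
import Algebra.Properties.Group
import Algebra.Properties.Monoid.Mult
import Algebra.Properties.Semiring.Exp
import Algebra.Properties.Semiring.Sum
import Algebra.Solver.Ring.NaturalCoefficients.Default
open import Data.Fin.Base using (Fin; zero; suc; toℕ; splitAt; opposite; punchIn; punchOut; fromℕ<)
open import Data.Fin.Properties
  using (suc-injective; toℕ-injective; toℕ<n; toℕ-fromℕ<; opposite-prop;
         punchIn-injective; punchInᵢ≢i; punchIn-punchOut)
  renaming (_≟_ to _≟ᶠ_)
open import Data.Integer.Base using (ℤ; +_)
open import Data.Integer.Divisibility.Signed using (_∣_)
open import Data.List.Base using (List; []; _∷_; map; drop)
open import Data.Nat.Base as ℕ using (ℕ; zero; suc; pred; _≤_; _<_; z≤n; s≤s)
import Data.Nat.Divisibility as ℕ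
import Data.Nat.Properties as ℕₚ
open import Data.Product.Base using (_×_; _,_; proj₁; proj₂; ∃-syntax)
open import Data.Sum.Base using (_⊎_; inj₁; inj₂; [_,_]′; fromInj₁)
  renaming (reduce to reduceSum)
open import Function.Base using (_∘_)
open import Relation.Binary.Definitions using (tri<; tri≈; tri>)
open import Relation.Binary.PropositionalEquality as ≡ using (_≡_; _≢_)
import Relation.Binary.Reasoning.Setoid
open import Relation.Nullary.Decidable using (Dec; yes; no; _×-dec_)
open import Relation.Nullary.Negation using (¬_; contradiction)

-- Evaluation, derivatives and homogenisation of polynomials over a commutative ring.

module PolynomialProperties {c ℓ} (R : CommutativeRing c ℓ) where

  open CommutativeRing R hiding (zero)
  open Polynomials R
  open Algebra.Definitions.RawSemiring (Semiring.rawSemiring semiring) using (_^_)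
  open Algebra.Solver.Ring.NaturalCoefficients.Default commutativeSemiring
    using (solve; _:=_; _:+_; _:*_)
  open Relation.Binary.Reasoning.Setoid setoid

  eval-zero : ∀ f x → (∀ k → coeff f k ≈ 0#) → eval f x ≈ 0#
  eval-zero []      x f≈0 = refl
  eval-zero (a ∷ f) x f≈0 = begin
    a + x * eval f x  ≈⟨ +-cong (f≈0 0) (*-congˡ (eval-zero f x (λ k → f≈0 (suc k)))) ⟩
    0# + x * 0#       ≈⟨ trans (+-identityˡ _) (zeroʳ x) ⟩
    0#                ∎

  eval-cong : ∀ f g x → f ≈ₚ g → eval f x ≈ eval g x
  eval-cong []      g       x f≈g = sym (eval-zero g x (λ k → sym (f≈g k)))
  eval-cong (a ∷ f) []      x f≈g = eval-zero (a ∷ f) x f≈g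
  eval-cong (a ∷ f) (b ∷ g) x f≈g =
    +-cong (f≈g 0) (*-congˡ (eval-cong f g x (λ k → f≈g (suc k))))

  eval-+ₚ : ∀ f g x → eval (f +ₚ g) x ≈ eval f x + eval g x
  eval-+ₚ []      g       x = sym (+-identityˡ _)
  eval-+ₚ (a ∷ f) []      x = sym (+-identityʳ _)
  eval-+ₚ (a ∷ f) (b ∷ g) x = trans (+-congˡ (*-congˡ (eval-+ₚ f g x)))
    (solve 5 (λ a b x u v → (a :+ b) :+ x :* (u :+ v) := (a :+ x :* u) :+ (b :+ x :* v))
      refl a b x (eval f x) (eval g x))

  eval-scale : ∀ a f x → eval (map (a *_) f) x ≈ a * eval f x
  eval-scale a []      x = sym (zeroʳ a)
  eval-scale a (b ∷ f) x = trans (+-congˡ (*-congˡ (eval-scale a f x)))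
    (solve 4 (λ a b x u → a :* b :+ x :* (a :* u) := a :* (b :+ x :* u))
      refl a b x (eval f x))

  eval-*ₚ : ∀ f g x → eval (f *ₚ g) x ≈ eval f x * eval g x
  eval-*ₚ []      g x = sym (zeroˡ _)
  eval-*ₚ (a ∷ f) g x = begin
    eval (map (a *_) g +ₚ (0# ∷ f *ₚ g)) x
      ≈⟨ eval-+ₚ (map (a *_) g) (0# ∷ f *ₚ g) x ⟩
    eval (map (a *_) g) x + (0# + x * eval (f *ₚ g) x)
      ≈⟨ +-cong (eval-scale a g x) (trans (+-identityˡ _) (*-congˡ (eval-*ₚ f g x))) ⟩
    a * eval g x + x * (eval f x * eval g x)
      ≈⟨ solve 4 (λ a x u v → a :* v :+ x :* (u :* v) := (a :+ x :* u) :* v)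
           refl a x (eval f x) (eval g x) ⟩
    (a + x * eval f x) * eval g x
      ∎

  eval-X^ : ∀ s f x → eval (X^[ s ]* f) x ≈ x ^ s * eval f x
  eval-X^ zero    f x = sym (*-identityˡ _)
  eval-X^ (suc s) f x = begin
    0# + x * eval (X^[ s ]* f) x  ≈⟨ +-identityˡ _ ⟩
    x * eval (X^[ s ]* f) x       ≈⟨ *-congˡ (eval-X^ s f x) ⟩
    x * (x ^ s * eval f x)        ≈⟨ *-assoc x _ _ ⟨
    x * x ^ s * eval f x          ∎

  coeff-X^-zero : ∀ s f {m} → (∀ k → m < k → coeff f k ≈ 0#) →
                  ∀ k → s ℕ.+ m < k → coeff (X^[ s ]* f) k ≈ 0#
  coeff-X^-zero zero    f top k       m<k       = top k m<k
  coeff-X^-zero (suc s) f top (suc k) (s≤s s+m<k) = coeff-X^-zero s f top k s+m<k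

  coeff-drop : ∀ m f k → coeff (drop m f) k ≡ coeff f (m ℕ.+ k)
  coeff-drop zero    f       k = ≡.refl
  coeff-drop (suc m) []      k = ≡.refl
  coeff-drop (suc m) (_ ∷ f) k = coeff-drop m f k

  eval-drop : ∀ m f x → eval (drop m f) x ≈ coeff f m + x * eval (drop (suc m) f) x
  eval-drop zero    []      x = sym (trans (+-identityˡ _) (zeroʳ x))
  eval-drop (suc m) []      x = sym (trans (+-identityˡ _) (zeroʳ x))
  eval-drop zero    (_ ∷ f) x = refl
  eval-drop (suc m) (_ ∷ f) x = eval-drop m f x

  eval-drop-zero : ∀ m f x → (∀ k → m ≤ k → coeff f k ≈ 0#) → eval (drop m f) x ≈ 0#
  eval-drop-zero m f x top = eval-zero (drop m f) x λ k →
    trans (reflexive (coeff-drop m f k)) (top (m ℕ.+ k) (ℕₚ.m≤m+n m k))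

  private
    eval-weighted-suc : ∀ k f x →
      eval (weighted (suc k) f) x ≈ eval f x + eval (weighted k f) x
    eval-weighted-suc k []      x = sym (+-identityˡ 0#)
    eval-weighted-suc k (a ∷ f) x = trans (+-congˡ (*-congˡ (eval-weighted-suc (suc k) f x)))
      (solve 5 (λ a b x u v → (a :+ b) :+ x :* (u :+ v) := (a :+ x :* u) :+ (b :+ x :* v))
        refl a _ x (eval f x) (eval (weighted (suc k) f) x))

  -- The product rule for a + x f, which turns statements about derivatives into inductions on the
  -- coefficient list.
  eval-derivative-∷ : ∀ a f x →
    eval (derivative (a ∷ f)) x ≈ eval f x + x * eval (derivative f) x
  eval-derivative-∷ a []      x = sym (trans (+-identityˡ _) (zeroʳ x))
  eval-derivative-∷ a (b ∷ f) x = trans (eval-weighted-suc 0 (b ∷ f) x) (+-congˡ (+-identityˡ _))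

  -- bⁿ f(a/b) for f of degree at most n; the coefficients beyond n are ignored.
  homogenise : ℕ → Poly → Carrier → Carrier → Carrier
  homogenise n       []      a b = 0#
  homogenise zero    (c ∷ f) a b = c
  homogenise (suc n) (c ∷ f) a b = c * b ^ suc n + a * homogenise n f a b

  -- Asking for `x * b ≈ a` in place of x = a/b avoids division, so the same induction serves ℚ with
  -- a fraction and ℤ/p with x = a b⁻¹.
  eval-homogenise : ∀ n f a b x → (∀ k → n < k → coeff f k ≈ 0#) → x * b ≈ a →
                    eval f x * b ^ n ≈ homogenise n f a b
  eval-homogenise n       []      a b x top xb≈a = zeroˡ _
  eval-homogenise zero    (c ∷ f) a b x top xb≈a = begin
    (c + x * eval f x) * 1#  ≈⟨ *-identityʳ _ ⟩
    c + x * eval f x         ≈⟨ +-congˡ (*-congˡ (eval-zero f x λ k → top (suc k) (s≤s z≤n))) ⟩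
    c + x * 0#               ≈⟨ trans (+-congˡ (zeroʳ x)) (+-identityʳ c) ⟩
    c                        ∎
  eval-homogenise (suc n) (c ∷ f) a b x top xb≈a = begin
    (c + x * eval f x) * (b * b ^ n)
      ≈⟨ solve 5 (λ c x e b b^n → (c :+ x :* e) :* (b :* b^n)
                                  := c :* (b :* b^n) :+ (x :* b) :* (e :* b^n))
           refl c x (eval f x) b (b ^ n) ⟩
    c * (b * b ^ n) + x * b * (eval f x * b ^ n)
      ≈⟨ +-congˡ (*-cong xb≈a (eval-homogenise n f a b x (λ k n<k → top (suc k) (s≤s n<k)) xb≈a)) ⟩
    c * (b * b ^ n) + a * homogenise n f a b
      ∎

  -- Every term below degree n carries a factor b. Hence a prime that divides b, but neither a nor
  -- the leading coefficient, does not divide the value of the form.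
  homogenise-leading : ∀ n f a b → ∃[ e ] homogenise n f a b ≈ coeff f n * a ^ n + b * e
  homogenise-leading n       []      a b = 0# , sym (trans (+-cong (zeroˡ _) (zeroʳ b)) (+-identityˡ 0#))
  homogenise-leading zero    (c ∷ f) a b = 0# , sym (trans (+-cong (*-identityʳ c) (zeroʳ b)) (+-identityʳ c))
  homogenise-leading (suc n) (c ∷ f) a b with e , eq ← homogenise-leading n f a b =
    c * b ^ n + a * e ,
    trans (+-congˡ (*-congˡ eq))
      (solve 7 (λ c b b^n a l a^n e → c :* (b :* b^n) :+ a :* (l :* a^n :+ b :* e)
                                      := l :* (a :* a^n) :+ b :* (c :* b^n :+ a :* e))
        refl c b (b ^ n) a (coeff f n) (a ^ n) e)

-- Column operations on determinants; the discriminant at a double root.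

module Determinants {c ℓ} (R : CommutativeRing c ℓ) where

  open CommutativeRing R hiding (zero)
  open Polynomials R
  open PolynomialProperties R
  open Algebra.Definitions.RawSemiring (Semiring.rawSemiring semiring) using (_^_; sum)
  open Algebra.Properties.Semiring.Sum semiring using (sum-cong-≋; ∑-distrib-+; *-distribˡ-sum)
  open Algebra.Properties.Group +-group using (identityʳ-unique)
  open Algebra.Solver.Ring.NaturalCoefficients.Default commutativeSemiring
    using (solve; _:=_; _:+_; _:*_; con)
  open Relation.Binary.Reasoning.Setoid setoid
  open Auxiliary using (det-cong; coeff-derivative; ·-zero)
  open Algebra.Properties.Monoid.Mult +-monoid using (×-congʳ)

  private
    laplaceTerm : ∀ {n} → Matrix (suc n) → Fin (suc n) → Carrier
    laplaceTerm M j = (- 1#) ^ toℕ j * (M zero j * det (minor M j))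

  -- Expand along the first row. At k = j the entry is linear and the minors agree, since they omit
  -- column j; at every other k the entries agree and the minor is linear by induction, in its
  -- column `punchOut k≢j`.
  det-column-linear : ∀ {n} (j : Fin n) a (A B C : Matrix n) →
    (∀ i k → k ≡ j → C i k ≈ A i k + a * B i k) →
    (∀ i k → k ≢ j → C i k ≈ A i k) → (∀ i k → k ≢ j → C i k ≈ B i k) →
    det C ≈ det A + a * det B
  det-column-linear {suc n} j a A B C C≈A+aB C≈A C≈B = begin
    sum (laplaceTerm C)
      ≈⟨ sum-cong-≋ term ⟩
    sum (λ k → laplaceTerm A k + a * laplaceTerm B k)
      ≈⟨ ∑-distrib-+ (laplaceTerm A) (λ k → a * laplaceTerm B k) ⟩
    sum (laplaceTerm A) + sum (λ k → a * laplaceTerm B k)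
      ≈⟨ +-congˡ (*-distribˡ-sum a (laplaceTerm B)) ⟨
    det A + a * det B
      ∎
    where
    term : ∀ k → laplaceTerm C k ≈ laplaceTerm A k + a * laplaceTerm B k
    term k with k ≟ᶠ j
    ... | yes ≡.refl = begin
      s * (C zero k * det (minor C k))
        ≈⟨ *-congˡ (*-congʳ (C≈A+aB zero k ≡.refl)) ⟩
      s * ((A zero k + a * B zero k) * det (minor C k))
        ≈⟨ solve 5 (λ s x a y d → s :* ((x :+ a :* y) :* d) := s :* (x :* d) :+ a :* (s :* (y :* d)))
             refl s (A zero k) a (B zero k) (det (minor C k)) ⟩
      s * (A zero k * det (minor C k)) + a * (s * (B zero k * det (minor C k)))
        ≈⟨ +-cong
             (*-congˡ (*-congˡ (det-cong _ _ λ i l → C≈A (suc i) _ (punchInᵢ≢i k l))))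
             (*-congˡ (*-congˡ (*-congˡ (det-cong _ _ λ i l → C≈B (suc i) _ (punchInᵢ≢i k l))))) ⟩
      laplaceTerm A k + a * laplaceTerm B k
        ∎
      where s = (- 1#) ^ toℕ k
    ... | no k≢j = begin
      s * (C zero k * det (minor C k))
        ≈⟨ *-congˡ (*-congˡ (det-column-linear (punchOut k≢j) a (minor A k) (minor B k) (minor C k)
             (λ i l l≡j → C≈A+aB (suc i) _ (≡.trans (≡.cong (punchIn k) l≡j) (punchIn-punchOut k≢j)))
             (λ i l l≢j → C≈A (suc i) _ (l≢j ∘ injective))
             (λ i l l≢j → C≈B (suc i) _ (l≢j ∘ injective)))) ⟩
      s * (C zero k * (det (minor A k) + a * det (minor B k)))
        ≈⟨ solve 5 (λ s x a d e → s :* (x :* (d :+ a :* e)) := s :* (x :* d) :+ a :* (s :* (x :* e)))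
             refl s (C zero k) a (det (minor A k)) (det (minor B k)) ⟩
      s * (C zero k * det (minor A k)) + a * (s * (C zero k * det (minor B k)))
        ≈⟨ +-cong (*-congˡ (*-congʳ (C≈A zero k k≢j)))
                  (*-congˡ (*-congˡ (*-congʳ (C≈B zero k k≢j)))) ⟩
      laplaceTerm A k + a * laplaceTerm B k
        ∎
      where
      s = (- 1#) ^ toℕ k
      injective : ∀ {l} → punchIn k l ≡ j → l ≡ punchOut k≢j
      injective {l} eq = punchIn-injective k l (punchOut k≢j) (≡.trans eq (≡.sym (punchIn-punchOut k≢j)))

  -- Linearity with A = B = C and a = 1 reads det A = det A + det A.
  det-zero-column : ∀ {n} (j : Fin n) (A : Matrix n) → (∀ i → A i j ≈ 0#) → det A ≈ 0#
  det-zero-column j A Aj≈0 = trans (sym (*-identityˡ _)) (identityʳ-unique _ _ (sym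
    (det-column-linear j 1# A A A
      (λ { i _ ≡.refl → sym (trans (+-congˡ (trans (*-identityˡ _) (Aj≈0 i))) (+-identityʳ _)) })
      (λ _ _ _ → refl) (λ _ _ _ → refl))))

  private
    Adjacent : ∀ {n} → Fin n → Fin n → Set
    Adjacent l r = toℕ r ≡ suc (toℕ l)

    sum-cong-adjacent : ∀ {n} (l r : Fin n) → Adjacent l r → (t u : Fin n → Carrier) →
      t l + t r ≈ u l + u r → (∀ k → k ≢ l → k ≢ r → t k ≈ u k) → sum t ≈ sum u
    sum-cong-adjacent {suc (suc n)} zero (suc zero) adj t u lr others = begin
      t zero + (t (suc zero) + sum (λ k → t (suc (suc k))))  ≈⟨ +-assoc _ _ _ ⟨
      t zero + t (suc zero) + sum (λ k → t (suc (suc k)))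
        ≈⟨ +-cong lr (sum-cong-≋ λ k → others (suc (suc k)) (λ ()) (λ ())) ⟩
      u zero + u (suc zero) + sum (λ k → u (suc (suc k)))    ≈⟨ +-assoc _ _ _ ⟩
      u zero + (u (suc zero) + sum (λ k → u (suc (suc k))))  ∎
    sum-cong-adjacent (suc l) (suc r) adj t u lr others = +-cong
      (others zero (λ ()) (λ ()))
      (sum-cong-adjacent l r (ℕₚ.suc-injective adj) (λ k → t (suc k)) (λ k → u (suc k)) lr
        (λ k k≢l k≢r → others (suc k) (λ { ≡.refl → k≢l ≡.refl }) (λ { ≡.refl → k≢r ≡.refl })))

    punchOut-adjacent : ∀ {n} {k l r : Fin (suc n)} (k≢l : k ≢ l) (k≢r : k ≢ r) →
                        Adjacent l r → Adjacent (punchOut k≢l) (punchOut k≢r)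
    punchOut-adjacent {_}     {zero}  {zero}          k≢l k≢r adj = contradiction ≡.refl k≢l
    punchOut-adjacent {_}     {zero}  {suc l} {suc r} k≢l k≢r adj = ℕₚ.suc-injective adj
    punchOut-adjacent {suc _} {suc zero}    {zero} {suc zero} k≢l k≢r adj = contradiction ≡.refl k≢r
    punchOut-adjacent {suc (suc _)} {suc (suc k)} {zero} {suc zero} k≢l k≢r adj = ≡.refl
    punchOut-adjacent {suc _} {suc k} {suc l} {suc r} k≢l k≢r adj =
      ≡.cong suc (punchOut-adjacent (k≢l ∘ ≡.cong suc) (k≢r ∘ ≡.cong suc) (ℕₚ.suc-injective adj))

    punchIn-adjacent-≡ : ∀ {n} (l r : Fin (suc n)) → Adjacent l r → ∀ k →
                         punchIn l k ≡ r → punchIn r k ≡ l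
    punchIn-adjacent-≡ zero    (suc zero) adj zero    eq = ≡.refl
    punchIn-adjacent-≡ (suc l) (suc r)    adj (suc k) eq =
      ≡.cong suc (punchIn-adjacent-≡ l r (ℕₚ.suc-injective adj) k (suc-injective eq))

    punchIn-adjacent-≢ : ∀ {n} (l r : Fin (suc n)) → Adjacent l r → ∀ k →
                         punchIn l k ≢ r → punchIn l k ≡ punchIn r k
    punchIn-adjacent-≢ zero    (suc zero) adj zero    neq = contradiction ≡.refl neq
    punchIn-adjacent-≢ zero    (suc zero) adj (suc k) neq = ≡.refl
    punchIn-adjacent-≢ (suc l) (suc r)    adj zero    neq = ≡.refl
    punchIn-adjacent-≢ (suc l) (suc r)    adj (suc k) neq =
      ≡.cong suc (punchIn-adjacent-≢ l r (ℕₚ.suc-injective adj) k (neq ∘ ≡.cong suc))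

  -- The terms k ≠ l, r of the Laplace expansion agree by induction. Term l gains a multiple of
  -- `det (minor A r)` through its minor, term r gains the same through its entry, and neighbouring
  -- columns carry opposite signs.
  det-add-adjacent : ∀ {n} (l r : Fin n) → toℕ r ≡ suc (toℕ l) → ∀ a (A B : Matrix n) →
    (∀ i k → k ≡ r → B i k ≈ A i k + a * A i l) →
    (∀ i k → k ≢ r → B i k ≈ A i k) → det B ≈ det A
  det-add-adjacent {suc n} l r adj a A B Br≈ B≈A =
    sum-cong-adjacent l r adj (laplaceTerm B) (laplaceTerm A) lr others
    where
    l≢r : l ≢ r
    l≢r ≡.refl = ℕₚ.1+n≢n (≡.sym adj)

    r′ = punchOut l≢r

    s = (- 1#) ^ toℕ l

    -- Since l and r are neighbours, putting column l in the place of column r in `minor A l` yields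
    -- `minor A r` without reordering columns, hence without a sign.
    minor-l : det (minor B l) ≈ det (minor A l) + a * det (minor A r)
    minor-l = det-column-linear r′ a (minor A l) (minor A r) (minor B l)
      (λ i k k≡r′ → let lk≡r = ≡.trans (≡.cong (punchIn l) k≡r′) (punchIn-punchOut l≢r) in
        trans (Br≈ (suc i) _ lk≡r)
          (+-congˡ (*-congˡ (reflexive (≡.cong (A (suc i)) (≡.sym (punchIn-adjacent-≡ l r adj k lk≡r)))))))
      (λ i k k≢r′ → B≈A (suc i) _ (lk≢r k≢r′))
      (λ i k k≢r′ → trans (B≈A (suc i) _ (lk≢r k≢r′))
        (reflexive (≡.cong (A (suc i)) (punchIn-adjacent-≢ l r adj k (lk≢r k≢r′)))))
      where
      lk≢r : ∀ {k} → k ≢ r′ → punchIn l k ≢ r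
      lk≢r {k} k≢r′ eq = k≢r′ (punchIn-injective l k r′ (≡.trans eq (≡.sym (punchIn-punchOut l≢r))))

    lr : laplaceTerm B l + laplaceTerm B r ≈ laplaceTerm A l + laplaceTerm A r
    lr = begin
      s * (B zero l * det (minor B l)) + (- 1#) ^ toℕ r * (B zero r * det (minor B r))
        ≈⟨ +-cong (*-congˡ (*-cong (B≈A zero l l≢r) minor-l))
             (*-cong sign (*-cong (Br≈ zero r ≡.refl)
               (det-cong (minor B r) (minor A r) λ i k → B≈A (suc i) _ (punchInᵢ≢i r k)))) ⟩
      s * (x * (d + a * e)) + - 1# * s * ((y + a * x) * e)
        -- `- 1#` is the opaque atom m here; the two gains are collected in a multiple of 1 + m.
        ≈⟨ solve 7 (λ s x d a e y m → s :* (x :* (d :+ a :* e)) :+ m :* s :* ((y :+ a :* x) :* e)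
                   := s :* (x :* d) :+ m :* s :* (y :* e) :+ (con 1 :+ m) :* (s :* (x :* (a :* e))))
             refl s x d a e y (- 1#) ⟩
      s * (x * d) + - 1# * s * (y * e) + (1# + - 1#) * (s * (x * (a * e)))
        ≈⟨ +-congˡ (*-congʳ (-‿inverseʳ 1#)) ⟩
      s * (x * d) + - 1# * s * (y * e) + 0# * (s * (x * (a * e)))
        ≈⟨ trans (+-congˡ (zeroˡ _)) (+-identityʳ _) ⟩
      s * (x * d) + - 1# * s * (y * e)
        ≈⟨ +-congˡ (*-congʳ sign) ⟨
      laplaceTerm A l + laplaceTerm A r
        ∎
      where
      x = A zero l
      y = A zero r
      d = det (minor A l)
      e = det (minor A r)
      sign : (- 1#) ^ toℕ r ≈ - 1# * s
      sign = reflexive (≡.cong ((- 1#) ^_) adj)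

    others : ∀ k → k ≢ l → k ≢ r → laplaceTerm B k ≈ laplaceTerm A k
    others k k≢l k≢r = *-congˡ (*-cong (B≈A zero k k≢r)
      (det-add-adjacent (punchOut k≢l) (punchOut k≢r) (punchOut-adjacent k≢l k≢r adj) a
        (minor A k) (minor B k)
        (λ i j j≡r → trans
          (Br≈ (suc i) _ (≡.trans (≡.cong (punchIn k) j≡r) (punchIn-punchOut k≢r)))
          (+-congˡ (*-congˡ (reflexive (≡.cong (A (suc i)) (≡.sym (punchIn-punchOut k≢l)))))))
        (λ i j j≢r → B≈A (suc i) _
          (λ eq → j≢r (punchIn-injective k j _ (≡.trans eq (≡.sym (punchIn-punchOut k≢r))))))))

  -- Horner's scheme as a sequence of column operations: adding x times each
  -- column to the next one, from left to right, turns the last column into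
  -- the values at x.
  det-common-root : ∀ {n} → 1 ≤ n → ∀ (g : Fin n → Poly) x →
    (∀ i k → n ≤ k → coeff (g i) k ≈ 0#) → (∀ i → eval (g i) x ≈ 0#) →
    det (λ i j → coeff (g i) (toℕ (opposite j))) ≈ 0#
  det-common-root {suc n} _ g x top root = trans (sym (det-H (suc n) ℕₚ.≤-refl))
    (det-zero-column last (H (suc n)) λ i → trans (H-< (suc n) i last (toℕ<n last))
      (trans (reflexive (≡.cong (λ m → eval (drop m (g i)) x) opposite-last)) (root i)))
    where
    last : Fin (suc n)
    last = fromℕ< ℕₚ.≤-refl

    opposite-last : toℕ (opposite last) ≡ 0
    opposite-last = ≡.trans (opposite-prop last)
      (≡.trans (≡.cong (n ℕ.∸_) (toℕ-fromℕ< (ℕₚ.≤-refl {suc n}))) (ℕₚ.n∸n≡0 n))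

    coeffs horner : Matrix (suc n)
    coeffs i j = coeff (g i) (toℕ (opposite j))
    horner i j = eval (drop (toℕ (opposite j)) (g i)) x

    -- Stage t of Horner's scheme, interpolating between `coeffs` at 0 and `horner` at n + 1.
    H : ℕ → Matrix (suc n)
    H t i j with toℕ j ℕₚ.<? t
    ... | yes _ = horner i j
    ... | no  _ = coeffs i j

    H-< : ∀ t i j → toℕ j < t → H t i j ≈ horner i j
    H-< t i j j<t with toℕ j ℕₚ.<? t
    ... | yes _   = refl
    ... | no  j≮t = contradiction j<t j≮t

    H-≥ : ∀ t i j → t ≤ toℕ j → H t i j ≈ coeffs i j
    H-≥ t i j t≤j with toℕ j ℕₚ.<? t
    ... | yes j<t = contradiction t≤j (ℕₚ.<⇒≱ j<t)
    ... | no  _   = refl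

    H-suc : ∀ t i j → toℕ j ≢ t → H (suc t) i j ≈ H t i j
    H-suc t i j j≢t with ℕₚ.<-cmp (toℕ j) t
    ... | tri< j<t _ _ = trans (H-< (suc t) i j (ℕₚ.m<n⇒m<1+n j<t)) (sym (H-< t i j j<t))
    ... | tri≈ _ j≡t _ = contradiction j≡t j≢t
    ... | tri> _ _ t<j = trans (H-≥ (suc t) i j t<j) (sym (H-≥ t i j (ℕₚ.<⇒≤ t<j)))

    det-H : ∀ t → t ≤ suc n → det (H t) ≈ det coeffs
    det-H zero    _   = det-cong (H 0) coeffs λ i j → H-≥ 0 i j z≤n
    -- Column 0 belongs to the power n, beyond which all coefficients vanish; its Horner value is
    -- the coefficient itself and no operation takes place.
    det-H (suc zero) _ = trans (det-cong (H 1) (H 0) step) (det-H 0 z≤n)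
      where
      step : ∀ i j → H 1 i j ≈ H 0 i j
      step i (suc j) = H-suc 0 i (suc j) (λ ())
      step i zero    = trans (H-< 1 i zero (s≤s z≤n)) (trans
        (trans (eval-drop m (g i) x) (trans
          (+-congˡ (trans (*-congˡ (eval-drop-zero (suc m) (g i) x top′)) (zeroʳ x)))
          (+-identityʳ _)))
        (sym (H-≥ 0 i zero z≤n)))
        where
        m = toℕ (opposite (zero {n}))
        top′ : ∀ k → suc m ≤ k → coeff (g i) k ≈ 0#
        top′ k le = top i k (≡.subst (λ v → suc v ≤ k) (opposite-prop (zero {n})) le)
    det-H (suc (suc t)) t<n = trans
      (det-add-adjacent l r adj x (H (suc t)) (H (suc (suc t))) at-r
        (λ i k k≢r → H-suc (suc t) i k (λ k≡t → k≢r (toℕ-injective (≡.trans k≡t (≡.sym r≡))))))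
      (det-H (suc t) (ℕₚ.<⇒≤ t<n))
      where
      l r : Fin (suc n)
      l = fromℕ< (ℕₚ.<⇒≤ t<n)
      r = fromℕ< t<n
      r≡ : toℕ r ≡ suc t
      r≡ = toℕ-fromℕ< t<n
      l≡ : toℕ l ≡ t
      l≡ = toℕ-fromℕ< (ℕₚ.<⇒≤ t<n)
      adj : toℕ r ≡ suc (toℕ l)
      adj = ≡.trans r≡ (≡.cong suc (≡.sym l≡))
      opposite-adj : suc (toℕ (opposite r)) ≡ toℕ (opposite l)
      opposite-adj = ≡.trans (≡.cong suc (opposite-prop r)) (≡.trans
        (≡.cong (λ v → suc (n ℕ.∸ v)) r≡) (≡.trans
        (≡.sym (ℕₚ.+-∸-assoc 1 (ℕₚ.≤-pred t<n))) (≡.trans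
        (≡.cong (n ℕ.∸_) (≡.sym l≡)) (≡.sym (opposite-prop l)))))
      at-r : ∀ i k → k ≡ r → H (suc (suc t)) i k ≈ H (suc t) i k + x * H (suc t) i l
      -- `eval-drop` is Horner's recursion yₘ = cₘ + x yₘ₊₁, and column l is the one of index m + 1.
      at-r i k ≡.refl = trans (H-< (suc (suc t)) i r (≡.subst (_< suc (suc t)) (≡.sym r≡) ℕₚ.≤-refl))
        (trans (eval-drop (toℕ (opposite r)) (g i) x) (+-cong
          (sym (H-≥ (suc t) i r (ℕₚ.≤-reflexive (≡.sym r≡))))
          (*-congˡ (trans (reflexive (≡.cong (λ m → eval (drop m (g i)) x) opposite-adj))
            (sym (H-< (suc t) i l (≡.subst (_< suc t) (≡.sym l≡) ℕₚ.≤-refl)))))))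

  -- Each row lists the coefficients of a shift of f or g, which vanishes at x along with f and g;
  -- `det-common-root` applies to these rows.
  resultant-common-root : ∀ m n f g x → 1 ≤ n ℕ.+ m →
    (∀ k → m < k → coeff f k ≈ 0#) → (∀ k → n < k → coeff g k ≈ 0#) →
    eval f x ≈ 0# → eval g x ≈ 0# → resultant m n f g ≈ 0#
  resultant-common-root m n f g x 1≤n+m f-top g-top f-root g-root =
    trans (det-cong (sylvester m n f g) (λ i j → coeff (row i) (toℕ (opposite j))) entries)
          (det-common-root 1≤n+m row x row-top row-root)
    where
    row : Fin (n ℕ.+ m) → Poly
    row i = [ (λ a → X^[ toℕ (opposite a) ]* f) , (λ b → X^[ toℕ (opposite b) ]* g) ]′ (splitAt n i)

    entries : ∀ i j → sylvester m n f g i j ≈ coeff (row i) (toℕ (opposite j))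
    entries i j with splitAt n i
    ... | inj₁ _ = refl
    ... | inj₂ _ = refl

    row-top : ∀ i k → n ℕ.+ m ≤ k → coeff (row i) k ≈ 0#
    row-top i k le with splitAt n i
    ... | inj₁ a = coeff-X^-zero (toℕ (opposite a)) f f-top k
      (ℕₚ.<-≤-trans (ℕₚ.+-monoˡ-< m (toℕ<n (opposite a))) le)
    ... | inj₂ b = coeff-X^-zero (toℕ (opposite b)) g g-top k
      (ℕₚ.<-≤-trans (ℕₚ.+-monoˡ-< n (toℕ<n (opposite b))) (≡.subst (_≤ k) (ℕₚ.+-comm n m) le))

    shift-root : ∀ s h → eval h x ≈ 0# → eval (X^[ s ]* h) x ≈ 0#
    shift-root s h h-root = trans (eval-X^ s h x) (trans (*-congˡ h-root) (zeroʳ _))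

    row-root : ∀ i → eval (row i) x ≈ 0#
    row-root i with splitAt n i
    ... | inj₁ a = shift-root (toℕ (opposite a)) f f-root
    ... | inj₂ b = shift-root (toℕ (opposite b)) g g-root

  -- Keeping the factor `coeff f n` relates the discriminant to the vanishing resultant over any
  -- commutative ring; it is cancelled only modulo a prime.
  leading*discriminant-double-root : ∀ f n x → 1 ≤ n → HasDegree f n →
    eval f x ≈ 0# → eval (derivative f) x ≈ 0# → coeff f n * discriminant n f ≈ 0#
  leading*discriminant-double-root f n@(suc n-1) x 1≤n deg@(_ , top) f-root f′-root = begin
    coeff f n * discriminant n f
      ≈⟨ leading*discriminant f n 1≤n deg ⟩
    discriminantSign n * resultant n (pred n) f (derivative f)
      ≈⟨ *-congˡ (resultant-common-root n (pred n) f (derivative f) x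
           (ℕₚ.≤-trans 1≤n (ℕₚ.m≤n+m n (pred n))) top top′ f-root f′-root) ⟩
    discriminantSign n * 0#
      ≈⟨ zeroʳ _ ⟩
    0#
      ∎
    where
    top′ : ∀ k → pred n < k → coeff (derivative f) k ≈ 0#
    top′ k lt = trans (coeff-derivative f k)
      (trans (×-congʳ (suc k) (top (suc k) (s≤s lt))) (·-zero (suc k)))

open import Data.Integer.Base as ℤ using (-[1+_]; 0ℤ; 1ℤ; ∣_∣; _+_; _*_; -_; _-_)
open import Data.Integer.Divisibility.Signed
  using (divides; _∣?_; ∣⇒∣ᵤ; ∣ᵤ⇒∣; ∣-refl; ∣-trans; ∣m∣n⇒∣m+n; ∣m+n∣m⇒∣n; ∣m+n∣n⇒∣m;
         ∣m⇒∣m*n; ∣n⇒∣m*n; *-monoˡ-∣; *-monoʳ-∣; *-cancelˡ-∣)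
open import Data.Integer.Properties as ℤₚ using (_≟_)
open import Data.Integer.Tactic.RingSolver using (solve-∀)
open import Data.List.Membership.Propositional using (_∈_)
open import Data.List.Relation.Unary.All using (_∷_)
open import Data.List.Relation.Unary.Any using (here; there)
open import Data.Nat.Coprimality using (Coprime; coprime-Bézout; recompute)
open import Data.Nat.GCD using (module Bézout)
open import Data.Nat.Induction using (<-rec)
open import Data.Nat.Primality
  using (Prime; prime[2]; euclidsLemma; prime⇒irreducible; prime⇒nonZero; prime⇒nonTrivial)
open import Data.Nat.Primality.Factorisation using (factorise)
import Data.Nat.Tactic.RingSolver as ℕSolver
open import Data.Rational.Base as ℚ using (ℚ; 0ℚ; 1ℚ; ↥_; ↧_)
open import Data.Rational.Literals using (fromℤ)
import Data.Rational.Properties as ℚₚ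
import Data.Rational.Unnormalised.Base as ℚᵘ
import Data.Rational.Unnormalised.Properties as ℚᵘₚ
open ≡ using (refl; sym; trans; cong; cong₂; subst; subst₂; module ≡-Reasoning)

open ℤ[x] using (eval; derivative; coeff; HasDegree)
open Algebra.Definitions.RawSemiring
  (Semiring.rawSemiring (CommutativeRing.semiring ℤₚ.+-*-commutativeRing)) using (_^_)
open Algebra.Properties.Semiring.Exp
  (CommutativeRing.semiring ℤₚ.+-*-commutativeRing) using (^-homo-*)
open Algebra.Solver.Ring.NaturalCoefficients.Default
  (CommutativeRing.commutativeSemiring ℚₚ.+-*-commutativeRing)
  using (solve; _:=_; _:+_; _:*_; con)

private
  module ℤP = PolynomialProperties ℤₚ.+-*-commutativeRing
  module ℚP = PolynomialProperties ℚₚ.+-*-commutativeRing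

-- Divisibility by primes

infix 4 _∤_ _∥_

_∤_ : ℤ → ℤ → Set
a ∤ b = ¬ (a ∣ b)

_∥_ : ℕ → ℤ → Set
p ∥ N = + p ∣ N × + p * + p ∤ N

i*j≢0 : ∀ {i j} → i ≢ 0ℤ → j ≢ 0ℤ → i * j ≢ 0ℤ
i*j≢0 {i} i≢0 j≢0 ij≡0 = [ i≢0 , j≢0 ]′ (ℤₚ.i*j≡0⇒i≡0∨j≡0 i ij≡0)

∣0 : ∀ a → a ∣ 0ℤ
∣0 a = divides 0ℤ (sym (ℤₚ.*-zeroˡ a))

∥⇒≢0 : ∀ {p N} → p ∥ N → N ≢ 0ℤ
∥⇒≢0 {p} (_ , p²∤N) refl = p²∤N (∣0 (+ p * + p))

private
  ep*b≡p*eb : ∀ e p b → e * p * b ≡ p * (e * b)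
  ep*b≡p*eb = solve-∀

module _ {p} (p-prime : Prime p) where

  private instance
    _ = prime⇒nonZero p-prime
    _ = prime⇒nonTrivial p-prime
    p-nonZero : ℤ.NonZero (+ p)
    p-nonZero = ℕ.≢-nonZero (ℕ.≢-nonZero⁻¹ p)

  prime≢0 : + p ≢ 0ℤ
  prime≢0 = ℕ.≢-nonZero⁻¹ p ∘ cong ∣_∣

  prime∤1 : + p ∤ 1ℤ
  prime∤1 p∣1 = ℕ.nonTrivial⇒≢1 (ℕ.∣1⇒≡1 (∣⇒∣ᵤ p∣1))

  prime∣* : ∀ a b → + p ∣ a * b → (+ p ∣ a) ⊎ (+ p ∣ b)
  prime∣* a b p∣ab with euclidsLemma ∣ a ∣ ∣ b ∣ p-prime (subst (p ℕ.∣_) (ℤₚ.abs-* a b) (∣⇒∣ᵤ p∣ab))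
  ... | inj₁ p∣a = inj₁ (∣ᵤ⇒∣ p∣a)
  ... | inj₂ p∣b = inj₂ (∣ᵤ⇒∣ p∣b)

  prime∤* : ∀ {a b} → + p ∤ a → + p ∤ b → + p ∤ a * b
  prime∤* {a} {b} p∤a p∤b p∣ab = [ p∤a , p∤b ]′ (prime∣* a b p∣ab)

  prime∤^ : ∀ {a} → + p ∤ a → ∀ n → + p ∤ a ^ n
  prime∤^ p∤a zero    = prime∤1
  prime∤^ p∤a (suc n) = prime∤* p∤a (prime∤^ p∤a n)

  p²∣pa⇒p∣a : ∀ a → + p * + p ∣ + p * a → + p ∣ a
  p²∣pa⇒p∣a a = *-cancelˡ-∣ (+ p)

  ∤⇒∥* : ∀ {a} → + p ∤ a → p ∥ a * + p
  ∤⇒∥* {a} p∤a = ∣n⇒∣m*n a ∣-refl , λ p²∣ap → p∤a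
    (p²∣pa⇒p∣a a (subst (+ p * + p ∣_) (ℤₚ.*-comm a (+ p)) p²∣ap))

  -- Euclid's lemma twice: one factor p of a is cancelled, then the cofactor must supply the second.
  p²∣ab∧p∤b⇒p²∣a : ∀ a b → + p ∤ b → + p * + p ∣ a * b → + p * + p ∣ a
  p²∣ab∧p∤b⇒p²∣a a b p∤b p²∣ab = case-a
    (fromInj₁ (λ p∣b → contradiction p∣b p∤b) (prime∣* a b
      (∣-trans {+ p} {+ p * + p} {a * b} (∣m⇒∣m*n {+ p} (+ p) ∣-refl) p²∣ab)))
    where
    case-a : + p ∣ a → + p * + p ∣ a
    case-a (divides e a≡ep) = subst (+ p * + p ∣_) (sym a≡ep) (*-monoˡ-∣ (+ p) {+ p} {e}
      (fromInj₁ (λ p∣b → contradiction p∣b p∤b) (prime∣* e b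
        (p²∣pa⇒p∣a (e * b) (subst (+ p * + p ∣_) ab≡peb p²∣ab)))))
      where
      ab≡peb : a * b ≡ + p * (e * b)
      ab≡peb = trans (cong (_* b) a≡ep) (ep*b≡p*eb e (+ p) b)

  -- If p divided k, then p² would divide the product; so p comes from d.
  ∥k²d⇒∣d : ∀ d k → p ∥ d * (k * k) → + p ∣ d
  ∥k²d⇒∣d d k (p∣N , p²∤N) with prime∣* d (k * k) p∣N
  ... | inj₁ p∣d = p∣d
  ... | inj₂ p∣k² = contradiction (∣n⇒∣m*n {+ p * + p} d {k * k}
    (∣-trans {+ p * + p} {k * + p} {k * k} (*-monoˡ-∣ (+ p) {+ p} {k} p∣k) (*-monoʳ-∣ k {+ p} {k} p∣k)))
    p²∤N
    where
    p∣k : + p ∣ k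
    p∣k = reduceSum (prime∣* k k p∣k²)

  inverse-mod : ∀ b → + p ∤ + b → ∃[ z ] ∃[ w ] z * + b ≡ 1ℤ + w * + p
  inverse-mod b p∤b with coprime-Bézout coprime
    where
    coprime : Coprime p b
    coprime (d∣p , d∣b) with prime⇒irreducible p-prime d∣p
    ... | inj₁ d≡1  = d≡1
    ... | inj₂ refl = contradiction (∣ᵤ⇒∣ d∣b) p∤b
  ... | Bézout.-+ x y eq = + y , + x , trans (sym (ℤₚ.pos-* y b))
    (trans (cong +_ (sym eq)) (cong (λ v → 1ℤ + v) (ℤₚ.pos-* x p)))
  -- Here 1 + y b = x p, so the inverse is the negative of y.
  ... | Bézout.+- x y eq = - + y , - + x , trans (lemma₁ (+ y) (+ b))
    (trans (cong (λ v → 1ℤ + v) (cong -_ eqℤ)) (lemma₂ (+ x) (+ p)))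
    where
    eqℤ : 1ℤ + + y * + b ≡ + x * + p
    eqℤ = trans (cong (λ v → 1ℤ + v) (sym (ℤₚ.pos-* y b))) (trans (cong +_ eq) (ℤₚ.pos-* x p))
    lemma₁ : ∀ y b → - y * b ≡ 1ℤ + - (1ℤ + y * b)
    lemma₁ = solve-∀
    lemma₂ : ∀ x p → 1ℤ + - (x * p) ≡ 1ℤ + - x * p
    lemma₂ = solve-∀

∃-prime-divisor : ∀ N → ∣ N ∣ ≢ 1 → ∃[ q ] (Prime q × + q ∣ N)
∃-prime-divisor N ∣N∣≢1 with ∣ N ∣ in eq
-- Zero is divisible by every prime; 2 is an arbitrary choice.
... | zero        = 2 , prime[2] , ∣ᵤ⇒∣ (subst (2 ℕ.∣_) (sym eq) (ℕ._∣0 2))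
... | n@(suc _) with factorise n
... | record { factors = [] ; isFactorisation = n≡1 } = contradiction n≡1 ∣N∣≢1
... | record { factors = q ∷ qs ; isFactorisation = n≡ ; factorsPrime = q-prime ∷ _ } =
  q , q-prime , ∣ᵤ⇒∣ (subst (q ℕ.∣_) (sym (trans eq n≡)) (ℕ.m∣m*n _))

-- The value 1 would force p E = 0, and the value -1 would force p to divide 2; oddness of p
-- excludes the latter.
∣1+pE∣≢1 : ∀ {p} → Prime p → p ≢ 2 → ∀ E → E ≢ 0ℤ → ∣ 1ℤ + + p * E ∣ ≢ 1
∣1+pE∣≢1 {p} p-prime p≢2 E E≢0 ∣N∣≡1 = cases (1ℤ + + p * E) (cancel (+ p * E)) ∣N∣≡1
  where
  cancel : ∀ x → - 1ℤ + (1ℤ + x) ≡ x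
  cancel = solve-∀
  cases : ∀ N → - 1ℤ + N ≡ + p * E → ∣ N ∣ ≢ 1
  cases (+ 1)    eq refl = i*j≢0 (prime≢0 p-prime) E≢0 (sym eq)
  cases -[1+ 0 ] eq refl
    with prime⇒irreducible prime[2] (∣⇒∣ᵤ (divides {+ p} { -[1+ 1 ] } E (trans eq (ℤₚ.*-comm (+ p) E))))
  ... | inj₁ refl = prime∤1 p-prime ∣-refl
  ... | inj₂ p≡2  = p≢2 p≡2

-- Euclid's argument: a prime dividing both 1 + p E and p E would divide 1. Whatever q has to avoid
-- is put into E as a factor.
fresh-prime : ∀ {p} → Prime p → p ≢ 2 → ∀ E → E ≢ 0ℤ →
              ∃[ q ] (Prime q × + q ∣ 1ℤ + + p * E × + q ∤ + p * E)
fresh-prime {p} p-prime p≢2 E E≢0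
  with q , q-prime , q∣N ← ∃-prime-divisor (1ℤ + + p * E) (∣1+pE∣≢1 p-prime p≢2 E E≢0) =
  q , q-prime , q∣N , λ q∣pE → prime∤1 q-prime (∣m+n∣n⇒∣m q∣N q∣pE)

-- Squarefree parts

-- Strong induction, dividing out a square j² with j > 1. A bounded search decides whether one
-- exists, because j ≤ j² ≤ n.
squarefree-decomposition-ℕ : ∀ n → n ≢ 0 →
  ∃[ d ] ∃[ k ] (n ≡ d ℕ.* (k ℕ.* k) × (∀ j → j ℕ.* j ℕ.∣ d → j ≡ 1))
squarefree-decomposition-ℕ = <-rec _ step
  where
  lemma : ∀ d k j → d ℕ.* (k ℕ.* k) ℕ.* (j ℕ.* j) ≡ d ℕ.* ((k ℕ.* j) ℕ.* (k ℕ.* j))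
  lemma = ℕSolver.solve-∀
  c<cj² : ∀ c j → 1 < j → c ℕ.* (j ℕ.* j) ≢ 0 → c < c ℕ.* (j ℕ.* j)
  c<cj² c j 1<j cj²≢0 = ℕₚ.m<m*n c (j ℕ.* j) {{ℕ.≢-nonZero λ { refl → cj²≢0 refl }}} (ℕₚ.*-mono-< 1<j 1<j)
  step : ∀ n → (∀ {m} → m < n → m ≢ 0 → _) → n ≢ 0 → _
  step n rec n≢0 with ℕₚ.anyUpTo? (λ j → (1 ℕₚ.<? j) ×-dec (j ℕ.* j ℕ.∣? n)) (suc n)
  ... | yes (j , _ , 1<j , ℕ.divides c refl)
    with d , k , refl , sf ← rec {c} (c<cj² c j 1<j n≢0) (λ { refl → n≢0 refl })
    = d , k ℕ.* j , lemma d k j , sf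
  ... | no none = n , 1 , sym (ℕₚ.*-identityʳ n) , sf
    where
    sf : ∀ j → j ℕ.* j ℕ.∣ n → j ≡ 1
    sf zero          0∣n   = contradiction (ℕ.0∣⇒≡0 0∣n) n≢0
    sf (suc zero)    _     = refl
    sf j@(suc (suc _)) j²∣n = contradiction (j , s≤s j≤n , s≤s (s≤s z≤n) , j²∣n) none
      where
      j≤n : j ≤ n
      j≤n = ℕₚ.≤-trans (ℕₚ.m≤m*n j j) (ℕ.∣⇒≤ {{ℕ.≢-nonZero n≢0}} j²∣n)

-- The sign of N goes into d; the rest comes from the absolute value.
squarefree-decomposition : ∀ N → N ≢ 0ℤ → ∃[ d ] ∃[ k ] (N ≡ d * (k * k) × Squarefree d)
squarefree-decomposition N N≢0
  with d , k , ∣N∣≡dk² , sf ← squarefree-decomposition-ℕ ∣ N ∣ (N≢0 ∘ ℤₚ.∣i∣≡0⇒i≡0)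
  with +∣N∣≡dk² ← trans (cong +_ ∣N∣≡dk²) (trans (ℤₚ.pos-* d (k ℕ.* k)) (cong (+ d *_) (ℤₚ.pos-* k k)))
  with ℤₚ.+∣i∣≡i⊎+∣i∣≡-i N
... | inj₁ ∣N∣≡N = + d , + k , trans (sym ∣N∣≡N) +∣N∣≡dk² ,
  λ j j²∣d → sf ∣ j ∣ (subst (ℕ._∣ d) (ℤₚ.abs-* j j) (∣⇒∣ᵤ j²∣d))
... | inj₂ ∣N∣≡-N = - + d , + k ,
  trans (sym (ℤₚ.neg-involutive N))
    (trans (cong -_ (trans (sym ∣N∣≡-N) +∣N∣≡dk²)) (ℤₚ.neg-distribˡ-* (+ d) (+ k * + k))) ,
  λ j j²∣d → sf ∣ j ∣ (subst₂ ℕ._∣_ (ℤₚ.abs-* j j) (ℤₚ.∣-i∣≡∣i∣ (+ d)) (∣⇒∣ᵤ j²∣d))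

-- ℤ inside ℚ

fromℤ-+ : ∀ a b → fromℤ (a + b) ≡ fromℤ a ℚ.+ fromℤ b
fromℤ-+ a b = ℚₚ.toℚᵘ-injective
  (ℚᵘₚ.≃-trans (ℚᵘ.*≡* (lemma a b)) (ℚᵘₚ.≃-sym (ℚₚ.toℚᵘ-homo-+ (fromℤ a) (fromℤ b))))
  where
  lemma : ∀ a b → (a + b) * 1ℤ ≡ (a * 1ℤ + b * 1ℤ) * 1ℤ
  lemma = solve-∀

fromℤ-* : ∀ a b → fromℤ (a * b) ≡ fromℤ a ℚ.* fromℤ b
fromℤ-* a b = ℚₚ.toℚᵘ-injective
  (ℚᵘₚ.≃-trans (ℚᵘ.*≡* refl) (ℚᵘₚ.≃-sym (ℚₚ.toℚᵘ-homo-* (fromℤ a) (fromℤ b))))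

fromℤ-injective : ∀ {a b} → fromℤ a ≡ fromℤ b → a ≡ b
fromℤ-injective = cong ↥_

*-↧ : ∀ q → q ℚ.* fromℤ (↧ q) ≡ fromℤ (↥ q)
*-↧ q@(ℚ.mkℚ n d-1 _) = ℚₚ.toℚᵘ-injective
  (ℚᵘₚ.≃-trans (ℚₚ.toℚᵘ-homo-* q (fromℤ (↧ q)))
    (ℚᵘ.*≡* (trans (ℤₚ.*-identityʳ _) (cong (λ d → n * + d) (sym (ℕₚ.*-identityʳ (suc d-1)))))))

module _ where
  open Algebra.Definitions.RawSemiring
    (Semiring.rawSemiring (CommutativeRing.semiring ℚₚ.+-*-commutativeRing))
    using () renaming (_^_ to _^ℚ_; _×_ to _·ℚ_)
  open Algebra.Definitions.RawSemiring
    (Semiring.rawSemiring (CommutativeRing.semiring ℤₚ.+-*-commutativeRing))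
    using () renaming (_×_ to _·_)

  fromℤ-^ : ∀ a n → fromℤ (a ^ n) ≡ fromℤ a ^ℚ n
  fromℤ-^ a zero    = refl
  fromℤ-^ a (suc n) = trans (fromℤ-* a (a ^ n)) (cong (fromℤ a ℚ.*_) (fromℤ-^ a n))

  fromℤ-· : ∀ n a → fromℤ (n · a) ≡ n ·ℚ fromℤ a
  fromℤ-· zero    a = refl
  fromℤ-· (suc n) a = trans (fromℤ-+ a (n · a)) (cong (fromℤ a ℚ.+_) (fromℤ-· n a))

  toℚ[x]-coeff : ∀ f k → ℚ[x].coeff (toℚ[x] f) k ≡ fromℤ (ℤ[x].coeff f k)
  toℚ[x]-coeff []      k       = refl
  toℚ[x]-coeff (a ∷ f) zero    = refl
  toℚ[x]-coeff (a ∷ f) (suc k) = toℚ[x]-coeff f k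

  toℚ[x]-weighted : ∀ k f → ℚ[x].weighted k (toℚ[x] f) ≡ toℚ[x] (ℤ[x].weighted k f)
  toℚ[x]-weighted k []      = refl
  toℚ[x]-weighted k (a ∷ f) = cong₂ _∷_ (sym (fromℤ-· k a)) (toℚ[x]-weighted (suc k) f)

  toℚ[x]-derivative : ∀ f → ℚ[x].derivative (toℚ[x] f) ≡ toℚ[x] (ℤ[x].derivative f)
  toℚ[x]-derivative []      = refl
  toℚ[x]-derivative (a ∷ f) = toℚ[x]-weighted 1 f

  toℚ[x]-eval : ∀ f x → ℚ[x].eval (toℚ[x] f) (fromℤ x) ≡ fromℤ (ℤ[x].eval f x)
  toℚ[x]-eval []      x = refl
  toℚ[x]-eval (a ∷ f) x = trans
    (cong (fromℤ a ℚ.+_) (trans (cong (fromℤ x ℚ.*_) (toℚ[x]-eval f x)) (sym (fromℤ-* x (ℤ[x].eval f x)))))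
    (sym (fromℤ-+ a (x * ℤ[x].eval f x)))

  toℚ[x]-homogenise : ∀ n f a b →
    ℚP.homogenise n (toℚ[x] f) (fromℤ a) (fromℤ b) ≡ fromℤ (ℤP.homogenise n f a b)
  toℚ[x]-homogenise n       []      a b = refl
  toℚ[x]-homogenise zero    (c ∷ f) a b = refl
  toℚ[x]-homogenise (suc n) (c ∷ f) a b = trans
    (cong₂ ℚ._+_
      (trans (cong (fromℤ c ℚ.*_) (sym (fromℤ-^ b (suc n)))) (sym (fromℤ-* c (b ^ suc n))))
      (trans (cong (fromℤ a ℚ.*_) (toℚ[x]-homogenise n f a b)) (sym (fromℤ-* a (ℤP.homogenise n f a b)))))
    (sym (fromℤ-+ (c * b ^ suc n) (a * ℤP.homogenise n f a b)))

  homogeneous-value : ∀ f n → ℤ[x].HasDegree f n → ∀ r a b → r ℚ.* fromℤ b ≡ fromℤ a →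
    ℚ[x].eval (toℚ[x] f) r ℚ.* fromℤ (b ^ n) ≡ fromℤ (ℤP.homogenise n f a b)
  homogeneous-value f n (_ , top) r a b rb≡a = trans
    (cong (ℚ[x].eval (toℚ[x] f) r ℚ.*_) (fromℤ-^ b n))
    (trans
      (ℚP.eval-homogenise n (toℚ[x] f) (fromℤ a) (fromℤ b) r
        (λ k n<k → trans (toℚ[x]-coeff f k) (cong fromℤ (top k n<k))) rb≡a)
      (toℚ[x]-homogenise n f a b))
evalℚ : ℤ[x].Poly → ℚ → ℚ
evalℚ f = ℚ[x].eval (toℚ[x] f)

-- Values of integer polynomials

-- In the induction x + h multiplies the expansion of the tail, and the product rule recovers the
-- derivative. Only the factor h² of the remainder matters later, so c stays unspecified.
taylor : ∀ f x h → ∃[ c ] eval f (x + h) ≡ eval f x + h * eval (derivative f) x + h * h * c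
taylor []      x h = 0ℤ , lemma h
  where
  lemma : ∀ h → 0ℤ ≡ 0ℤ + h * 0ℤ + h * h * 0ℤ
  lemma = solve-∀
taylor (a ∷ f) x h = let c , eq = taylor f x h in
  eval (derivative f) x + (x + h) * c ,
  trans (cong (λ v → a + (x + h) * v) eq)
    (trans (lemma a x h (eval f x) (eval (derivative f) x) c)
      (cong (λ v → a + x * eval f x + h * v + h * h * (eval (derivative f) x + (x + h) * c))
        (sym (ℤP.eval-derivative-∷ a f x))))
  where
  lemma : ∀ a x h F F′ c → a + (x + h) * (F + h * F′ + h * h * c) ≡
                           a + x * F + h * (F + x * F′) + h * h * (F′ + (x + h) * c)
  lemma = solve-∀

eval-shift : ∀ f x h → ∃[ e ] eval f (x + h) ≡ eval f x + h * e
eval-shift f x h = let c , eq = taylor f x h in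
  eval (derivative f) x + h * c , trans eq (lemma (eval f x) h (eval (derivative f) x) c)
  where
  lemma : ∀ F h F′ c → F + h * F′ + h * h * c ≡ F + h * (F′ + h * c)
  lemma = solve-∀

-- If the tail f is nonzero at x, then a + x f(x) = 0 gives |x| ≤ |x f(x)| = |a|; so the bound for
-- the tail, increased by |a|, suffices.
nonzero-beyond : ∀ f n → HasDegree f n → ∃[ M ] (∀ x → M < ∣ x ∣ → eval f x ≢ 0ℤ)
nonzero-beyond []      n       (lead≢0 , top) = contradiction refl lead≢0
nonzero-beyond (a ∷ f) zero    (lead≢0 , top) = 0 , λ x _ a+xf≡0 → lead≢0
  (trans (sym (trans (cong (λ v → a + x * v) (ℤP.eval-zero f x (λ k → top (suc k) (s≤s z≤n))))
    (trans (cong (λ v → a + v) (ℤₚ.*-zeroʳ x)) (ℤₚ.+-identityʳ a)))) a+xf≡0)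
nonzero-beyond (a ∷ f) (suc n) (lead≢0 , top) =
  let M , rec = nonzero-beyond f n (lead≢0 , λ k n<k → top (suc k) (s≤s n<k)) in
  M ℕ.+ ∣ a ∣ , λ x M+a<x a+xf≡0 → ℕₚ.<⇒≱ (ℕₚ.≤-<-trans (ℕₚ.m≤n+m ∣ a ∣ M) M+a<x)
    (x≤a x (rec x (ℕₚ.≤-<-trans (ℕₚ.m≤m+n M ∣ a ∣) M+a<x)) a+xf≡0)
  where
  x≤a : ∀ x → eval f x ≢ 0ℤ → a + x * eval f x ≡ 0ℤ → ∣ x ∣ ≤ ∣ a ∣
  x≤a x fx≢0 eq = subst (∣ x ∣ ≤_)
    (trans (sym (ℤₚ.abs-* x (eval f x))) (trans (sym (ℤₚ.∣-i∣≡∣i∣ (x * eval f x)))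
      (cong ∣_∣ (trans (lemma a (x * eval f x)) (trans (cong (λ v → a - v) eq) (ℤₚ.+-identityʳ a))))))
    (ℕₚ.m≤m*n ∣ x ∣ ∣ eval f x ∣ {{ℤ.≢-nonZero fx≢0}})
    where
    lemma : ∀ a y → - y ≡ a - (a + y)
    lemma = solve-∀

-- `nonzero-beyond` applied to f - c: as n ≥ 1, only the constant term changes and the degree is
-- kept.
≢-beyond : ∀ f n → 1 ≤ n → HasDegree f n → ∀ c → ∃[ M ] (∀ x → M < ∣ x ∣ → eval f x ≢ c)
≢-beyond []      n       1≤n (lead≢0 , top) c = contradiction refl lead≢0
≢-beyond (a ∷ f) (suc n) 1≤n (lead≢0 , top) c =
  let M , ≢0 = nonzero-beyond (a - c ∷ f) (suc n) (lead≢0 , λ { (suc k) n<k → top (suc k) n<k }) in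
  M , λ x M<x fx≡c → ≢0 x M<x
    (trans (lemma a c (x * eval f x)) (trans (cong (_- c) fx≡c) (ℤₚ.+-inverseʳ c)))
  where
  lemma : ∀ a c y → a - c + y ≡ a + y - c
  lemma = solve-∀

-- D is the product of the denominators of the coefficients, so one D serves all arguments m.
clear-denominators : ∀ u → ∃[ D ] (D ≢ 0ℤ ×
  (∀ m → ∃[ z ] fromℤ D ℚ.* ℚ[x].eval u (fromℤ m) ≡ fromℤ z))
clear-denominators []      = 1ℤ , (λ ()) , λ m → 0ℤ , refl
clear-denominators (a ∷ u) = let D , D≢0 , clear = clear-denominators u in
  ↧ a * D , i*j≢0 {↧ a} (λ ()) D≢0 , λ m → let z , eq = clear m in
  ↥ a * D + ↧ a * (m * z) , (begin
    fromℤ (↧ a * D) ℚ.* (a ℚ.+ fromℤ m ℚ.* ℚ[x].eval u (fromℤ m))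
      ≡⟨ cong (ℚ._* (a ℚ.+ fromℤ m ℚ.* ℚ[x].eval u (fromℤ m))) (fromℤ-* (↧ a) D) ⟩
    fromℤ (↧ a) ℚ.* fromℤ D ℚ.* (a ℚ.+ fromℤ m ℚ.* ℚ[x].eval u (fromℤ m))
      ≡⟨ solve 5 (λ d D a m E → d :* D :* (a :+ m :* E) := a :* d :* D :+ d :* (m :* (D :* E)))
           refl (fromℤ (↧ a)) (fromℤ D) a (fromℤ m) (ℚ[x].eval u (fromℤ m)) ⟩
    a ℚ.* fromℤ (↧ a) ℚ.* fromℤ D ℚ.+ fromℤ (↧ a) ℚ.* (fromℤ m ℚ.* (fromℤ D ℚ.* ℚ[x].eval u (fromℤ m)))
      ≡⟨ cong₂ (λ s t → s ℚ.* fromℤ D ℚ.+ fromℤ (↧ a) ℚ.* (fromℤ m ℚ.* t)) (*-↧ a) eq ⟩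
    fromℤ (↥ a) ℚ.* fromℤ D ℚ.+ fromℤ (↧ a) ℚ.* (fromℤ m ℚ.* fromℤ z)
      ≡⟨ cong₂ ℚ._+_ (fromℤ-* (↥ a) D)
           (trans (fromℤ-* (↧ a) (m * z)) (cong (fromℤ (↧ a) ℚ.*_) (fromℤ-* m z))) ⟨
    fromℤ (↥ a * D) ℚ.+ fromℤ (↧ a * (m * z))
      ≡⟨ fromℤ-+ (↥ a * D) (↧ a * (m * z)) ⟨
    fromℤ (↥ a * D + ↧ a * (m * z)) ∎)
  where open ≡-Reasoning

-- Clear denominators in u f + v f′ = 1. A prime dividing both f(m) and f′(m) then divides the fixed
-- D, whatever m is.
separable-values : ∀ f → Separable f → ∃[ D ] (D ≢ 0ℤ ×
  (∀ m → ∃[ a ] ∃[ b ] a * eval f m + b * eval (derivative f) m ≡ D))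
separable-values f (u , v , uf+vf′≈1) =
  let D , D≢0 , clear-u = clear-denominators u
      E , E≢0 , clear-v = clear-denominators v in
  D * E , i*j≢0 D≢0 E≢0 , λ m →
  let a , Du≡a = clear-u m
      b , Ev≡b = clear-v m
      M  = fromℤ m
      U  = ℚ[x].eval u M
      V  = ℚ[x].eval v M
      F  = eval f m
      F′ = eval (derivative f) m in
  E * a , D * b , fromℤ-injective (begin
    fromℤ (E * a * F + D * b * F′)
      ≡⟨ trans (fromℤ-+ (E * a * F) (D * b * F′)) (cong₂ ℚ._+_
           (trans (fromℤ-* (E * a) F) (cong (ℚ._* fromℤ F) (fromℤ-* E a)))
           (trans (fromℤ-* (D * b) F′) (cong (ℚ._* fromℤ F′) (fromℤ-* D b)))) ⟩
    fromℤ E ℚ.* fromℤ a ℚ.* fromℤ F ℚ.+ fromℤ D ℚ.* fromℤ b ℚ.* fromℤ F′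
      ≡⟨ cong₂ (λ s t → fromℤ E ℚ.* s ℚ.* fromℤ F ℚ.+ fromℤ D ℚ.* t ℚ.* fromℤ F′) Du≡a Ev≡b ⟨
    fromℤ E ℚ.* (fromℤ D ℚ.* U) ℚ.* fromℤ F ℚ.+ fromℤ D ℚ.* (fromℤ E ℚ.* V) ℚ.* fromℤ F′
      ≡⟨ solve 6 (λ E D U F V F′ → E :* (D :* U) :* F :+ D :* (E :* V) :* F′
                                   := D :* E :* (U :* F :+ V :* F′))
           refl (fromℤ E) (fromℤ D) U (fromℤ F) V (fromℤ F′) ⟩
    fromℤ D ℚ.* fromℤ E ℚ.* (U ℚ.* fromℤ F ℚ.+ V ℚ.* fromℤ F′)
      ≡⟨ cong (fromℤ D ℚ.* fromℤ E ℚ.*_) (one m) ⟩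
    fromℤ D ℚ.* fromℤ E ℚ.* 1ℚ
      ≡⟨ ℚₚ.*-identityʳ _ ⟩
    fromℤ D ℚ.* fromℤ E
      ≡⟨ fromℤ-* D E ⟨
    fromℤ (D * E) ∎)
  where
  open ≡-Reasoning
  one : ∀ m → ℚ[x].eval u (fromℤ m) ℚ.* fromℤ (eval f m)
              ℚ.+ ℚ[x].eval v (fromℤ m) ℚ.* fromℤ (eval (derivative f) m) ≡ 1ℚ
  one m = begin
    ℚ[x].eval u (fromℤ m) ℚ.* fromℤ (eval f m)
      ℚ.+ ℚ[x].eval v (fromℤ m) ℚ.* fromℤ (eval (derivative f) m)
      ≡⟨ cong₂ (λ s t → ℚ[x].eval u (fromℤ m) ℚ.* s ℚ.+ ℚ[x].eval v (fromℤ m) ℚ.* t)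
           (sym (toℚ[x]-eval f m))
           (trans (sym (toℚ[x]-eval (derivative f) m))
                  (cong (λ g → ℚ[x].eval g (fromℤ m)) (sym (toℚ[x]-derivative f)))) ⟩
    ℚ[x].eval u (fromℤ m) ℚ.* ℚ[x].eval (toℚ[x] f) (fromℤ m)
      ℚ.+ ℚ[x].eval v (fromℤ m) ℚ.* ℚ[x].eval (ℚ[x].derivative (toℚ[x] f)) (fromℤ m)
      ≡⟨ cong₂ ℚ._+_ (ℚP.eval-*ₚ u (toℚ[x] f) (fromℤ m))
                     (ℚP.eval-*ₚ v (ℚ[x].derivative (toℚ[x] f)) (fromℤ m)) ⟨
    ℚ[x].eval (u ℚ[x].*ₚ toℚ[x] f) (fromℤ m)
      ℚ.+ ℚ[x].eval (v ℚ[x].*ₚ ℚ[x].derivative (toℚ[x] f)) (fromℤ m)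
      ≡⟨ ℚP.eval-+ₚ (u ℚ[x].*ₚ toℚ[x] f) (v ℚ[x].*ₚ ℚ[x].derivative (toℚ[x] f)) (fromℤ m) ⟨
    ℚ[x].eval (u ℚ[x].*ₚ toℚ[x] f ℚ[x].+ₚ v ℚ[x].*ₚ ℚ[x].derivative (toℚ[x] f)) (fromℤ m)
      ≡⟨ ℚP.eval-cong (u ℚ[x].*ₚ toℚ[x] f ℚ[x].+ₚ v ℚ[x].*ₚ ℚ[x].derivative (toℚ[x] f))
             ℚ[x].1ₚ (fromℤ m) uf+vf′≈1 ⟩
    1ℚ ℚ.+ fromℤ m ℚ.* 0ℚ
      ≡⟨ trans (cong (1ℚ ℚ.+_) (ℚₚ.*-zeroʳ (fromℤ m))) (ℚₚ.+-identityʳ 1ℚ) ⟩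
    1ℚ ∎
-- Reduction modulo p

module _ (p : ℕ) where

  private
    module F = Polynomials (ℤ/ p)
    module FP = PolynomialProperties (ℤ/ p)
  open Algebra.Definitions.RawSemiring
    (Semiring.rawSemiring (CommutativeRing.semiring (ℤ/ p)))
    using () renaming (_^_ to _^ₚ_)
  open Algebra.Definitions.RawMonoid
    (Monoid.rawMonoid (CommutativeRing.+-monoid (ℤ/ p)))
    using () renaming (_×_ to _·ₚ_)
  open Algebra.Definitions.RawMonoid
    (Monoid.rawMonoid (CommutativeRing.+-monoid ℤₚ.+-*-commutativeRing))
    using () renaming (_×_ to _·_)

  ∣⇒≡0 : ∀ {a} → + p ∣ a → a ≡ 0ℤ [mod p ]
  ∣⇒≡0 {a} = subst (+ p ∣_) (sym (ℤₚ.+-identityʳ a))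

  ≡0⇒∣ : ∀ {a} → a ≡ 0ℤ [mod p ] → + p ∣ a
  ≡0⇒∣ {a} = subst (+ p ∣_) (ℤₚ.+-identityʳ a)

  -- Reduction changes only the equality, not the carrier or the operations. Hence this and the next
  -- lemmas, up to `reduce-homogenise`, are equalities of integers and not just congruences.
  reduce-coeff : ∀ f k → F.coeff f k ≡ coeff f k
  reduce-coeff []      k       = refl
  reduce-coeff (a ∷ f) zero    = refl
  reduce-coeff (a ∷ f) (suc k) = reduce-coeff f k

  reduce-· : ∀ k a → k ·ₚ a ≡ k · a
  reduce-· zero    a = refl
  reduce-· (suc k) a = cong (λ v → a + v) (reduce-· k a)

  reduce-^ : ∀ a n → a ^ₚ n ≡ a ^ n
  reduce-^ a zero    = refl
  reduce-^ a (suc n) = cong (a *_) (reduce-^ a n)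

  reduce-weighted : ∀ k f → F.weighted k f ≡ ℤ[x].weighted k f
  reduce-weighted k []      = refl
  reduce-weighted k (a ∷ f) = cong₂ _∷_ (reduce-· k a) (reduce-weighted (suc k) f)

  reduce-derivative : ∀ f → F.derivative f ≡ derivative f
  reduce-derivative []      = refl
  reduce-derivative (a ∷ f) = reduce-weighted 1 f

  reduce-homogenise : ∀ n f a b → FP.homogenise n f a b ≡ ℤP.homogenise n f a b
  reduce-homogenise n       []      a b = refl
  reduce-homogenise zero    (c ∷ f) a b = refl
  reduce-homogenise (suc n) (c ∷ f) a b =
    cong₂ (λ s t → c * s + a * t) (reduce-^ b (suc n)) (reduce-homogenise n f a b)

  homogenise-mod : ∀ f n → HasDegree f n → ∀ a b x → x * b ≡ a [mod p ] →
                   eval f x * b ^ n ≡ ℤP.homogenise n f a b [mod p ]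
  homogenise-mod f n (_ , top) a b x xb≡a = subst₂ (λ s t → eval f x * s ≡ t [mod p ])
    (reduce-^ b n) (reduce-homogenise n f a b)
    (FP.eval-homogenise n f a b x
      (λ k n<k → ∣⇒≡0 (subst (+ p ∣_) (sym (trans (reduce-coeff f k) (top k n<k))) (∣0 (+ p)))) xb≡a)

-- Identifies the degree stored in `Good` with the given n.
degree-unique : ∀ f {m n} → HasDegree f m → HasDegree f n → m ≡ n
degree-unique f {m} {n} (m≢0 , m-top) (n≢0 , n-top) with ℕₚ.<-cmp m n
... | tri< m<n _ _ = contradiction (m-top n m<n) n≢0
... | tri≈ _ m≡n _ = m≡n
... | tri> _ _ n<m = contradiction (n-top m n<m) m≢0

module _ {f n p} (deg : HasDegree f n) (good : Good p f) where

  open Good good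

  good-leading : + p ∤ coeff f n
  good-leading p∣lead with refl ← degree-unique f hasDegree deg =
    proj₁ reduced-degree (∣⇒≡0 p (subst (+ p ∣_) (sym (reduce-coeff p f n)) p∣lead))

  -- A root shared with f′ would make the leading coefficient times the discriminant vanish modulo
  -- p; as p is prime, one of the two would vanish, against goodness.
  good-simple-root : 1 ≤ n → ∀ a → + p ∣ eval f a → + p ∤ eval (derivative f) a
  good-simple-root 1≤n a p∣fa p∣f′a with refl ← degree-unique f hasDegree deg =
    [ (λ p∣lead → proj₁ reduced-degree (∣⇒≡0 p p∣lead))
    , (λ p∣disc → discriminant≢0 (∣⇒≡0 p p∣disc)) ]′
    (prime∣* prime (ModularPoly.coeff p f n) (ModularPoly.discriminant p n f)
      (≡0⇒∣ p (Determinants.leading*discriminant-double-root (ℤ/ p) f n a 1≤n reduced-degree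
        (∣⇒≡0 p p∣fa)
        (∣⇒≡0 p (subst (λ g → + p ∣ eval g a) (sym (reduce-derivative p f)) p∣f′a)))))

-- Square classes of values

module _ where
  open ≡-Reasoning

  square-quotient : ∀ v W D K .{{_ : ℚ.NonZero W}} .{{_ : ℚ.NonZero D}} →
    v ℚ.* (W ℚ.* W) ≡ D ℚ.* (K ℚ.* K) → v ℚ.÷ D ≡ (K ℚ.÷ W) ℚ.* (K ℚ.÷ W)
  square-quotient v W D K vW²≡DK² = begin
    v ℚ.* 1/D
      ≡⟨ solve 2 (λ v d → v :* d := v :* d :* (con 1 :* con 1)) refl v 1/D ⟩
    v ℚ.* 1/D ℚ.* (1ℚ ℚ.* 1ℚ)
      ≡⟨ cong (λ u → v ℚ.* 1/D ℚ.* (u ℚ.* u)) (ℚₚ.*-inverseʳ W) ⟨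
    v ℚ.* 1/D ℚ.* (W ℚ.* 1/W ℚ.* (W ℚ.* 1/W))
      ≡⟨ solve 4 (λ v d W w → v :* d :* (W :* w :* (W :* w)) := v :* (W :* W) :* (d :* (w :* w)))
           refl v 1/D W 1/W ⟩
    v ℚ.* (W ℚ.* W) ℚ.* (1/D ℚ.* (1/W ℚ.* 1/W))
      ≡⟨ cong (ℚ._* (1/D ℚ.* (1/W ℚ.* 1/W))) vW²≡DK² ⟩
    D ℚ.* (K ℚ.* K) ℚ.* (1/D ℚ.* (1/W ℚ.* 1/W))
      ≡⟨ solve 4 (λ D K d w → D :* (K :* K) :* (d :* (w :* w)) := D :* d :* (K :* w :* (K :* w)))
           refl D K 1/D 1/W ⟩
    D ℚ.* 1/D ℚ.* (K ℚ.* 1/W ℚ.* (K ℚ.* 1/W))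
      ≡⟨ trans (cong (ℚ._* (K ℚ.* 1/W ℚ.* (K ℚ.* 1/W))) (ℚₚ.*-inverseʳ D)) (ℚₚ.*-identityˡ _) ⟩
    K ℚ.* 1/W ℚ.* (K ℚ.* 1/W) ∎
    where
    1/D = ℚ.1/ D
    1/W = ℚ.1/ W

-- For N ≠ 0 this puts N in the square class of some f(r), so that prime divisors of S(f(r)) can be
-- read off an integer.
IsValueUpToSquares : ℤ[x].Poly → ℤ → Set
IsValueUpToSquares f N = ∃[ r ] ∃[ w ] (w ≢ 0ℤ × evalℚ f r ℚ.* fromℤ (w * w) ≡ fromℤ N)

-- With N = d k² one has f(r)/d = (k/w)². The same d serves all primes, which allows p and q to be
-- imposed on it together.
squarefree-part : ∀ f N → N ≢ 0ℤ → IsValueUpToSquares f N →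
  ∃[ d ] (𝒮 f d × (∀ {p} → Prime p → p ∥ N → + p ∣ d))
squarefree-part f N N≢0 (r , w , w≢0 , fr*w²≡N) =
  let d , k , N≡dk² , sf = squarefree-decomposition N N≢0
      d≢0 : d ≢ 0ℤ
      d≢0 d≡0 = N≢0 (trans N≡dk² (trans (cong (_* (k * k)) d≡0) (ℤₚ.*-zeroˡ (k * k))))
      instance
        d-nonZero : ℤ.NonZero d
        d-nonZero = ℤ.≢-nonZero d≢0
        w-nonZero : ℤ.NonZero w
        w-nonZero = ℤ.≢-nonZero w≢0 in
  d ,
  (r , fr≢0 , record
    { squarefree = sf
    ; quotient   = fromℤ k ℚ.÷ fromℤ w ,
        square-quotient (evalℚ f r) (fromℤ w) (fromℤ d) (fromℤ k)
          (trans (cong (evalℚ f r ℚ.*_) (sym (fromℤ-* w w)))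
            (trans fr*w²≡N (trans (cong fromℤ N≡dk²)
              (trans (fromℤ-* d (k * k)) (cong (fromℤ d ℚ.*_) (fromℤ-* k k))))))
    }) ,
  λ {p} p-prime p∥N → ∥k²d⇒∣d p-prime d k (subst (p ∥_) N≡dk² p∥N)
  where
  fr≢0 : evalℚ f r ≢ 0ℚ
  fr≢0 fr≡0 = N≢0 (fromℤ-injective
    (trans (sym fr*w²≡N) (trans (cong (ℚ._* fromℤ (w * w)) fr≡0) (ℚₚ.*-zeroˡ (fromℤ (w * w))))))

-- Zeros in the list are skipped to keep B nonzero; this loses nothing, since members of `𝒮 f` are
-- nonzero.
common-multiple : ∀ xs → ∃[ B ] (B ≢ 0ℤ × (∀ d → d ≢ 0ℤ → d ∈ xs → d ∣ B))
common-multiple []       = 1ℤ , (λ ()) , λ d _ ()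
common-multiple (x ∷ xs) = let B , B≢0 , multiple = common-multiple xs in extend B B≢0 multiple
  where
  extend : ∀ B → B ≢ 0ℤ → (∀ d → d ≢ 0ℤ → d ∈ xs → d ∣ B) →
           ∃[ C ] (C ≢ 0ℤ × (∀ d → d ≢ 0ℤ → d ∈ x ∷ xs → d ∣ C))
  extend B B≢0 multiple with x ≟ 0ℤ
  ... | yes x≡0 = B , B≢0 , λ
    { d d≢0 (here d≡x) → contradiction (trans d≡x x≡0) d≢0 ; d d≢0 (there d∈xs) → multiple d d≢0 d∈xs }
  ... | no  x≢0 = x * B , i*j≢0 x≢0 B≢0 , λ
    { d d≢0 (here refl)  → ∣m⇒∣m*n {d} {d} B ∣-refl
    ; d d≢0 (there d∈xs) → ∣n⇒∣m*n {d} x {B} (multiple d d≢0 d∈xs) }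

infinite-multiples : ∀ f p → Prime p →
  (∀ B → B ≢ 0ℤ → ∃[ N ] ∃[ q ] (IsValueUpToSquares f N × p ∥ N × Prime q × q ∥ N × + q ∤ B)) →
  Infinite (λ d → 𝒮 f d × + p ∣ d)
infinite-multiples f p p-prime values xs =
  let B , B≢0 , multiple = common-multiple xs
      N , q , value , p∥N , q-prime , q∥N , q∤B = values B B≢0
      d , d∈𝒮@(_ , _ , sp) , ∥⇒∣ = squarefree-part f N (∥⇒≢0 p∥N) value in
  d , (d∈𝒮 , ∥⇒∣ p-prime p∥N) ,
  λ d∈xs → q∤B (∣-trans {+ q} {d} {B} (∥⇒∣ q-prime q∥N)
    (multiple d (ℕ.≢-nonZero⁻¹ ∣ d ∣ {{IsSquarefreePart.nonZero sp}} ∘ cong ∣_∣) d∈xs))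
^≢0 : ∀ {a} → a ≢ 0ℤ → ∀ n → a ^ n ≢ 0ℤ
^≢0 a≢0 zero    = λ ()
^≢0 a≢0 (suc n) = i*j≢0 a≢0 (^≢0 a≢0 n)

odd⇒suc-double : ∀ n → 2 ℕ.∤ n → ∃[ k ] suc n ≡ k ℕ.+ k
odd⇒suc-double zero          2∤n = contradiction (2 ℕ.∣0) 2∤n
odd⇒suc-double (suc zero)    2∤n = 1 , refl
odd⇒suc-double (suc (suc n)) 2∤n =
  let k , eq = odd⇒suc-double n (2∤n ∘ ℕ.∣m∣n⇒∣m+n ℕ.∣-refl) in
  suc k , trans (cong (λ v → suc (suc v)) eq) (cong suc (sym (ℕₚ.+-suc k k)))

even⇒double : ∀ n → 2 ℕ.∣ n → ∃[ m ] n ≡ m ℕ.+ m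
even⇒double n (ℕ.divides m n≡m*2) =
  m , trans n≡m*2 (trans (ℕₚ.*-comm m 2) (cong (m ℕ.+_) (ℕₚ.+-identityʳ m)))

-- Odd degree

odd-degree-values : ∀ f n → HasDegree f n → 2 ℕ.∤ n → ∀ p → Good p f → ∀ B → B ≢ 0ℤ →
  ∃[ N ] ∃[ q ] (IsValueUpToSquares f N × p ∥ N × Prime q × q ∥ N × + q ∤ B)
odd-degree-values f n deg 2∤n p good B B≢0 =
  -- E = `lead * B` makes q avoid p, the leading coefficient and B at once.
  let q , q-prime , _ , q∤pE = fresh-prime p-prime (Good.odd good) (lead * B) (i*j≢0 (proj₁ deg) B≢0) in
  values q q-prime (λ q∣p → q∤pE (∣m⇒∣m*n {+ q} {+ p} (lead * B) q∣p))
    (λ q∣lead → q∤pE (∣n⇒∣m*n {+ q} (+ p) {lead * B} (∣m⇒∣m*n {+ q} {lead} B q∣lead)))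
    (λ q∣B → q∤pE (∣n⇒∣m*n {+ q} (+ p) {lead * B} (∣n⇒∣m*n {+ q} lead {B} q∣B)))
  where
  p-prime = Good.prime good
  lead = coeff f n

  values : ∀ q → Prime q → + q ∤ + p → + q ∤ lead → + q ∤ B →
    ∃[ N ] ∃[ q ] (IsValueUpToSquares f N × p ∥ N × Prime q × q ∥ N × + q ∤ B)
  values q q-prime q∤p q∤lead q∤B =
    -- F b = F p q with F prime to p and q, so each of the two primes occurs exactly once.
    F * b , q , (r , b ^ k , ^≢0 b≢0 k , value) ,
    subst (p ∥_) (lemma₁ F (+ p) (+ q)) (∤⇒∥* p-prime (prime∤* p-prime {F} {+ q}
      (∤F p-prime (∣m⇒∣m*n {+ p} {+ p} (+ q) ∣-refl) (good-leading deg good)) p∤q)) ,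
    q-prime ,
    subst (q ∥_) (lemma₂ F (+ p) (+ q)) (∤⇒∥* q-prime (prime∤* q-prime {F} {+ p}
      (∤F q-prime (∣n⇒∣m*n {+ q} (+ p) {+ q} ∣-refl) q∤lead) q∤p)) ,
    q∤B
    where
    open ≡-Reasoning
    b = + p * + q
    k = proj₁ (odd⇒suc-double n 2∤n)
    F = ℤP.homogenise n f 1ℤ b

    lemma₁ : ∀ F p q → F * q * p ≡ F * (p * q)
    lemma₁ = solve-∀
    lemma₂ : ∀ F p q → F * p * q ≡ F * (p * q)
    lemma₂ = solve-∀

    b≢0 : b ≢ 0ℤ
    b≢0 = i*j≢0 (prime≢0 p-prime) (prime≢0 q-prime)

    p∤q : + p ∤ + q
    p∤q p∣q with prime⇒irreducible q-prime (∣⇒∣ᵤ p∣q)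
    ... | inj₁ refl = prime∤1 p-prime ∣-refl
    ... | inj₂ refl = q∤p ∣-refl

    -- Modulo a prime divisor ℓ of b the form F reduces to the leading coefficient times 1ⁿ.
    ∤F : ∀ {ℓ} → Prime ℓ → + ℓ ∣ b → + ℓ ∤ lead → + ℓ ∤ F
    ∤F {ℓ} ℓ-prime ℓ∣b ℓ∤lead ℓ∣F =
      let e , F≡ = ℤP.homogenise-leading n f 1ℤ b in
      prime∤* ℓ-prime {lead} {1ℤ ^ n} ℓ∤lead (prime∤^ ℓ-prime (prime∤1 ℓ-prime) n)
        (∣m+n∣n⇒∣m {+ ℓ} {lead * 1ℤ ^ n} {b * e} (subst (+ ℓ ∣_) F≡ ℓ∣F) (∣m⇒∣m*n {+ ℓ} {b} e ℓ∣b))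

    instance
      b-nonZero : ℤ.NonZero b
      b-nonZero = ℤ.≢-nonZero b≢0

    r : ℚ
    r = ℚ.1/ fromℤ b

    value : evalℚ f r ℚ.* fromℤ (b ^ k * b ^ k) ≡ fromℤ (F * b)
    value = begin
      evalℚ f r ℚ.* fromℤ (b ^ k * b ^ k)
        -- As n is odd, the square of bᵏ is bⁿ⁺¹: here bⁿ clears the denominators of f(1/b), and one
        -- b is left over.
        ≡⟨ cong (λ v → evalℚ f r ℚ.* fromℤ v) (trans (sym (^-homo-* b k k))
             (trans (cong (b ^_) (sym (proj₂ (odd⇒suc-double n 2∤n)))) (ℤₚ.*-comm b (b ^ n)))) ⟩
      evalℚ f r ℚ.* fromℤ (b ^ n * b)
        ≡⟨ trans (cong (evalℚ f r ℚ.*_) (fromℤ-* (b ^ n) b))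
             (sym (ℚₚ.*-assoc (evalℚ f r) (fromℤ (b ^ n)) (fromℤ b))) ⟩
      evalℚ f r ℚ.* fromℤ (b ^ n) ℚ.* fromℤ b
        ≡⟨ cong (ℚ._* fromℤ b) (homogeneous-value f n deg r 1ℤ b (ℚₚ.*-inverseˡ (fromℤ b))) ⟩
      fromℤ F ℚ.* fromℤ b
        ≡⟨ fromℤ-* F b ⟨
      fromℤ (F * b) ∎

-- Even degree

coprime-parts : ∀ t {p} → Prime p → + p ∣ ↥ t → + p ∤ ↧ t
coprime-parts (ℚ.mkℚ n d-1 coprime) p-prime p∣n p∣d
  with refl ← recompute coprime (∣⇒∣ᵤ p∣n , ∣⇒∣ᵤ p∣d) = prime∤1 p-prime ∣-refl

root-mod : ∀ f n → HasDegree f n → 2 ℕ.∣ n → ∀ p → Good p f →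
           ∃[ d ] (𝒮 f d × + p ∣ d) → HasRootMod p f
root-mod f n deg 2∣n p good (d , (r , _ , part) , p∣d) = root
  where
  open ≡-Reasoning
  open IsSquarefreePart part using (nonZero; squarefree)
  p-prime = Good.prime good
  m = proj₁ (even⇒double n 2∣n)
  a = ↥ r
  b = ↧ r
  F = ℤP.homogenise n f a b
  s = proj₁ (IsSquarefreePart.quotient part)
  -- With n = 2m the factor bⁿ is a square and is absorbed: F = d t², where u/w is t in lowest
  -- terms.
  t = s ℚ.* fromℤ (b ^ m)
  u = ↥ t
  w = ↧ t

  fr≡ds² : evalℚ f r ≡ fromℤ d ℚ.* (s ℚ.* s)
  fr≡ds² = begin
    evalℚ f r
      ≡⟨ ℚₚ.*-identityʳ _ ⟨
    evalℚ f r ℚ.* 1ℚ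
      ≡⟨ cong (evalℚ f r ℚ.*_) (ℚₚ.*-inverseˡ (fromℤ d)) ⟨
    evalℚ f r ℚ.* (ℚ.1/ fromℤ d ℚ.* fromℤ d)
      ≡⟨ ℚₚ.*-assoc (evalℚ f r) (ℚ.1/ fromℤ d) (fromℤ d) ⟨
    evalℚ f r ℚ.÷ fromℤ d ℚ.* fromℤ d
      ≡⟨ trans (cong (ℚ._* fromℤ d) (proj₂ (IsSquarefreePart.quotient part))) (ℚₚ.*-comm (s ℚ.* s) (fromℤ d)) ⟩
    fromℤ d ℚ.* (s ℚ.* s) ∎

  Fw²≡du² : F * (w * w) ≡ d * (u * u)
  Fw²≡du² = fromℤ-injective (begin
    fromℤ (F * (w * w))
      ≡⟨ trans (fromℤ-* F (w * w)) (cong (fromℤ F ℚ.*_) (fromℤ-* w w)) ⟩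
    fromℤ F ℚ.* (fromℤ w ℚ.* fromℤ w)
      ≡⟨ cong (ℚ._* (fromℤ w ℚ.* fromℤ w)) (homogeneous-value f n deg r a b (*-↧ r)) ⟨
    evalℚ f r ℚ.* fromℤ (b ^ n) ℚ.* (fromℤ w ℚ.* fromℤ w)
      ≡⟨ cong₂ (λ v c → v ℚ.* c ℚ.* (fromℤ w ℚ.* fromℤ w)) fr≡ds²
           (trans (cong fromℤ (trans (cong (b ^_) (proj₂ (even⇒double n 2∣n))) (^-homo-* b m m)))
             (fromℤ-* (b ^ m) (b ^ m))) ⟩
    fromℤ d ℚ.* (s ℚ.* s) ℚ.* (fromℤ (b ^ m) ℚ.* fromℤ (b ^ m)) ℚ.* (fromℤ w ℚ.* fromℤ w)
      ≡⟨ solve 4 (λ d s c w → d :* (s :* s) :* (c :* c) :* (w :* w) := d :* (s :* c :* w :* (s :* c :* w)))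
           refl (fromℤ d) s (fromℤ (b ^ m)) (fromℤ w) ⟩
    fromℤ d ℚ.* (t ℚ.* fromℤ w ℚ.* (t ℚ.* fromℤ w))
      ≡⟨ cong (λ v → fromℤ d ℚ.* (v ℚ.* v)) (*-↧ t) ⟩
    fromℤ d ℚ.* (fromℤ u ℚ.* fromℤ u)
      ≡⟨ trans (fromℤ-* d (u * u)) (cong (fromℤ d ℚ.*_) (fromℤ-* u u)) ⟨
    fromℤ (d * (u * u)) ∎)

  -- If p divided w, it would not divide u, and p² dividing d u² would contradict the squarefreeness
  -- of d.
  p∤w : + p ∤ w
  p∤w p∣w = prime∤1 p-prime (subst (λ v → + p ∣ + v) (squarefree (+ p) p²∣d) ∣-refl)
    where
    p∤u : + p ∤ u
    p∤u p∣u = coprime-parts t p-prime p∣u p∣w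
    p²∣w² : + p * + p ∣ w * w
    p²∣w² = ∣-trans {+ p * + p} {w * + p} {w * w}
      (*-monoˡ-∣ (+ p) {+ p} {w} p∣w) (*-monoʳ-∣ w {+ p} {w} p∣w)
    p²∣d : + p * + p ∣ d
    p²∣d = p²∣ab∧p∤b⇒p²∣a p-prime d (u * u) (prime∤* p-prime {u} {u} p∤u p∤u)
      (subst (+ p * + p ∣_) Fw²≡du² (∣n⇒∣m*n {+ p * + p} F {w * w} p²∣w²))

  p∣F : + p ∣ F
  p∣F = fromInj₁ (λ p∣w² → contradiction p∣w² (prime∤* p-prime {w} {w} p∤w p∤w))
    (prime∣* p-prime F (w * w) (subst (+ p ∣_) (sym Fw²≡du²) (∣m⇒∣m*n {+ p} {d} (u * u) p∣d)))

  -- If p divided b, then F would be congruent to the leading coefficient times aⁿ with a prime to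
  -- p, against `p∣F`.
  p∤b : + p ∤ b
  p∤b p∣b = prime∤* p-prime {coeff f n} {a ^ n} (good-leading deg good)
    (prime∤^ p-prime {a} (λ p∣a → coprime-parts r p-prime p∣a p∣b) n)
    (∣m+n∣n⇒∣m {+ p} {coeff f n * a ^ n} {b * proj₁ leading} (subst (+ p ∣_) (proj₂ leading) p∣F)
      (∣m⇒∣m*n {+ p} {b} (proj₁ leading) p∣b))
    where leading = ℤP.homogenise-leading n f a b

  root : HasRootMod p f
  root =
    let z , v , zb≡1+vp = inverse-mod p-prime (ℚ.↧ₙ r) p∤b
        -- x is a/b modulo p, so f(x) bⁿ is congruent to F.
        x = a * z
        xb≡a : x * b ≡ a [mod p ]
        xb≡a = divides (a * v) (trans (cong (_- a) (trans (ℤₚ.*-assoc a z b) (cong (a *_) zb≡1+vp)))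
          (lemma₁ a v (+ p)))
        p∣fx*bⁿ : + p ∣ eval f x * b ^ n
        p∣fx*bⁿ = subst (+ p ∣_) (lemma₂ (eval f x * b ^ n) F)
          (∣m∣n⇒∣m+n {+ p} {eval f x * b ^ n - F} {F} (homogenise-mod p f n deg a b x xb≡a) p∣F) in
    x , ∣⇒≡0 p (fromInj₁ (λ p∣bⁿ → contradiction p∣bⁿ (prime∤^ p-prime {b} p∤b n))
      (prime∣* p-prime (eval f x) (b ^ n) p∣fx*bⁿ))
    where
    lemma₁ : ∀ a v p → a * (1ℤ + v * p) - a ≡ a * v * p
    lemma₁ = solve-∀
    lemma₂ : ∀ y F → y - F + F ≡ y
    lemma₂ = solve-∀

-- If q² divides f(y), moving y by s q changes f(y) by s q f′(y) modulo q² and so destroys this;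
-- otherwise y stays. The factor s makes room for a second prime: it is 1 when lifting at p and p²
-- when lifting at q.
simple-root-lift : ∀ {q} → Prime q → ∀ f y s → + q ∣ eval f y → + q ∤ eval (derivative f) y → + q ∤ s →
                   ∃[ k ] q ∥ eval f (y + s * (+ q * k))
simple-root-lift {q} q-prime f y s q∣fy q∤f′y q∤s = lift (+ q * + q ∣? eval f y)
  where
  lemma₀ : ∀ y s q → y ≡ y + s * (q * 0ℤ)
  lemma₀ = solve-∀
  lemma₁ : ∀ s q F′ → s * (q * 1ℤ) * F′ ≡ q * (s * F′)
  lemma₁ = solve-∀
  lemma₂ : ∀ s q c → s * (q * 1ℤ) * (s * (q * 1ℤ)) * c ≡ s * s * c * (q * q)
  lemma₂ = solve-∀

  lift : Dec (+ q * + q ∣ eval f y) → ∃[ k ] q ∥ eval f (y + s * (+ q * k))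
  lift (no  q²∤fy) = 0ℤ , subst (λ v → q ∥ eval f v) (lemma₀ y s (+ q)) (q∣fy , q²∤fy)
  lift (yes q²∣fy) = 1ℤ , subst (q ∥_) (sym (proj₂ expansion)) (q∣ , q²∤)
    where
    h = s * (+ q * 1ℤ)
    F′ = eval (derivative f) y
    expansion = taylor f y h
    c = proj₁ expansion

    q²∣hhc : + q * + q ∣ h * h * c
    q²∣hhc = divides (s * s * c) (lemma₂ s (+ q) c)

    q∣ : + q ∣ eval f y + h * F′ + h * h * c
    q∣ = ∣m∣n⇒∣m+n {+ q} {eval f y + h * F′} {h * h * c}
      (∣m∣n⇒∣m+n {+ q} {eval f y} {h * F′} q∣fy
        (subst (+ q ∣_) (sym (lemma₁ s (+ q) F′)) (∣m⇒∣m*n {+ q} {+ q} (s * F′) ∣-refl)))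
      (∣-trans {+ q} {+ q * + q} {h * h * c} (∣m⇒∣m*n {+ q} {+ q} (+ q) ∣-refl) q²∣hhc)

    q²∤ : + q * + q ∤ eval f y + h * F′ + h * h * c
    q²∤ q²∣ = prime∤* q-prime {s} {F′} q∤s q∤f′y (p²∣pa⇒p∣a q-prime (s * F′)
      (subst (+ q * + q ∣_) (lemma₁ s (+ q) F′)
        (∣m+n∣m⇒∣n {+ q * + q} {eval f y} {h * F′}
          (∣m+n∣n⇒∣m {+ q * + q} {eval f y + h * F′} {h * h * c} q²∣ q²∣hhc) q²∣fy)))

-- A move by a multiple of p² does not change f modulo p².
∥-shift : ∀ {p} f x z → p ∥ eval f x → p ∥ eval f (x + + p * + p * z)
∥-shift {p} f x z (p∣fx , p²∤fx) =
  let e , eq = eval-shift f x (+ p * + p * z)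
      p²∣ : + p * + p ∣ + p * + p * z * e
      p²∣ = ∣m⇒∣m*n {+ p * + p} {+ p * + p * z} e (∣m⇒∣m*n {+ p * + p} {+ p * + p} z ∣-refl) in
  subst (p ∥_) (sym eq)
    ( ∣m∣n⇒∣m+n {+ p} {eval f x} {+ p * + p * z * e} p∣fx
        (∣-trans {+ p} {+ p * + p} {+ p * + p * z * e} (∣m⇒∣m*n {+ p} {+ p} (+ p) ∣-refl) p²∣)
    , λ p²∣sum → p²∤fx (∣m+n∣n⇒∣m {+ p * + p} {eval f x} {+ p * + p * z * e} p²∣sum p²∣))

-- Since |S| ≥ 1, the multiple S t with t = M + |a| + 1 has absolute value at least t, and adding a
-- costs at most |a|.
far-term : ∀ a S M → S ≢ 0ℤ → M < ∣ a + S * + suc (M ℕ.+ ∣ a ∣) ∣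
far-term a S M S≢0 = ℕₚ.+-cancelʳ-≤ (∣ a ∣) (suc M) (∣ y ∣) (begin
  suc M ℕ.+ ∣ a ∣            ≤⟨ ℕₚ.m≤n*m (suc (M ℕ.+ ∣ a ∣)) ∣ S ∣ {{ℤ.≢-nonZero S≢0}} ⟩
  ∣ S ∣ ℕ.* suc (M ℕ.+ ∣ a ∣)  ≡⟨ ℤₚ.abs-* S t ⟨
  ∣ S * t ∣                  ≡⟨ cong ∣_∣ (lemma a (S * t)) ⟩
  ∣ y - a ∣                  ≤⟨ ℤₚ.∣i-j∣≤∣i∣+∣j∣ y a ⟩
  ∣ y ∣ ℕ.+ ∣ a ∣            ∎)
  where
  open ℕₚ.≤-Reasoning
  t = + suc (M ℕ.+ ∣ a ∣)
  y = a + S * t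
  lemma : ∀ a b → b ≡ a + b - a
  lemma = solve-∀

even-degree-values : ∀ f n → HasDegree f n → 1 ≤ n → Separable f → ∀ p → Good p f → HasRootMod p f →
  ∀ B → B ≢ 0ℤ → ∃[ N ] ∃[ q ] (IsValueUpToSquares f N × p ∥ N × Prime q × q ∥ N × + q ∤ B)
even-degree-values f n deg 1≤n separable p good (a₀ , fa₀≡0) B B≢0 =
  let q , q-prime , q∣1+pE , q∤pE = fresh-prime p-prime (Good.odd good) E E≢0 in
  values q q-prime q∣1+pE
    (λ q∣p → q∤pE (∣m⇒∣m*n {+ q} {+ p} E q∣p))
    (λ q∣BD → q∤pE (∣n⇒∣m*n {+ q} (+ p) {E} (∣m⇒∣m*n {+ q} {+ p * (B * D) * t} e
      (∣m⇒∣m*n {+ q} {+ p * (B * D)} t (∣n⇒∣m*n {+ q} (+ p) {B * D} q∣BD)))))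
  where
  p-prime = Good.prime good
  D   = proj₁ (separable-values f separable)
  D≢0 = proj₁ (proj₂ (separable-values f separable))

  p∣fa₀ : + p ∣ eval f a₀
  p∣fa₀ = ≡0⇒∣ p fa₀≡0

  lifted = simple-root-lift p-prime f a₀ 1ℤ p∣fa₀ (good-simple-root deg good 1≤n a₀ p∣fa₀) (prime∤1 p-prime)

  a = a₀ + 1ℤ * (+ p * proj₁ lifted)
  c = eval f a

  p∥c : p ∥ c
  p∥c = proj₂ lifted

  -- The factor c lets f(y) be divided by c, B D keeps q away from B and D, and p² preserves p ∥ f.
  S = + p * + p * (c * (B * D))

  S≢0 : S ≢ 0ℤ
  S≢0 = i*j≢0 {+ p * + p} {c * (B * D)} (i*j≢0 (prime≢0 p-prime) (prime≢0 p-prime))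
    (i*j≢0 {c} {B * D} (∥⇒≢0 p∥c) (i*j≢0 B≢0 D≢0))

  -- Beyond this bound f does not take the value c, which makes E nonzero.
  beyond = ≢-beyond f n 1≤n deg c
  t = + suc (proj₁ beyond ℕ.+ ∣ a ∣)
  y = a + S * t
  e = proj₁ (eval-shift f a (S * t))
  -- f(y) - c = S t e, and dividing this by c leaves p E.
  E = + p * (B * D) * t * e

  fy≡ : eval f y ≡ c * (1ℤ + + p * E)
  fy≡ = trans (proj₂ (eval-shift f a (S * t))) (lemma c (+ p) (B * D) t e)
    where
    lemma : ∀ c p B t e → c + p * p * (c * B) * t * e ≡ c * (1ℤ + p * (p * B * t * e))
    lemma = solve-∀

  E≢0 : E ≢ 0ℤ
  E≢0 E≡0 = proj₂ beyond y (far-term a S (proj₁ beyond) S≢0)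
    (trans fy≡ (trans (cong (λ v → c * (1ℤ + + p * v)) E≡0) (lemma c (+ p))))
    where
    lemma : ∀ c p → c * (1ℤ + p * 0ℤ) ≡ c
    lemma = solve-∀

  values : ∀ q → Prime q → + q ∣ 1ℤ + + p * E → + q ∤ + p → + q ∤ B * D →
    ∃[ N ] ∃[ q ] (IsValueUpToSquares f N × p ∥ N × Prime q × q ∥ N × + q ∤ B)
  values q q-prime q∣1+pE q∤p q∤BD =
    -- x is an integer, so w = 1. It differs from a by a multiple of p², which keeps p ∥ f(x).
    eval f x , q , (fromℤ x , 1ℤ , (λ ()) , trans (ℚₚ.*-identityʳ _) (toℚ[x]-eval f x)) ,
    subst (λ v → p ∥ eval f v) (lemma a (+ p) (c * (B * D)) t (+ q * k)) (∥-shift f a _ p∥c) ,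
    q-prime , proj₂ lifted′ , λ q∣B → q∤BD (∣m⇒∣m*n {+ q} {B} D q∣B)
    where
    lemma : ∀ a p C t z → a + p * p * (C * t + z) ≡ a + p * p * C * t + p * p * z
    lemma = solve-∀

    q∣fy : + q ∣ eval f y
    q∣fy = subst (+ q ∣_) (sym fy≡) (∣n⇒∣m*n {+ q} c {1ℤ + + p * E} q∣1+pE)

    -- Otherwise q would divide D, an integer combination of f(y) and f′(y).
    q∤f′y : + q ∤ eval (derivative f) y
    q∤f′y q∣f′y =
      let u , v , uf+vf′≡D = proj₂ (proj₂ (separable-values f separable)) y in
      q∤BD (∣n⇒∣m*n {+ q} B {D} (subst (+ q ∣_) uf+vf′≡D
        (∣m∣n⇒∣m+n {+ q} {u * eval f y} {v * eval (derivative f) y}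
          (∣n⇒∣m*n {+ q} u {eval f y} q∣fy) (∣n⇒∣m*n {+ q} v {eval (derivative f) y} q∣f′y))))

    lifted′ = simple-root-lift q-prime f y (+ p * + p) q∣fy q∤f′y (prime∤* q-prime {+ p} {+ p} q∤p q∤p)
    k = proj₁ lifted′
    x = y + + p * + p * (+ q * k)

theorem2p5 : ∀ (f : ℤ[x].Poly) (n : ℕ) → ℤ[x].HasDegree f n → 1 ≤ n → Separable f →
    ∀ (p : ℕ) → Good p f →
    (2 ℕ.∤ n → Infinite (λ d → 𝒮 f d × + p ∣ d))
    × (2 ℕ.∣ n →
    ((∃[ d ] (𝒮 f d × + p ∣ d)) → HasRootMod p f)
    × (HasRootMod p f → Infinite (λ d → 𝒮 f d × + p ∣ d)))
theorem2p5 f n deg 1≤n separable p good =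
  (λ 2∤n → infinite-multiples f p (Good.prime good) (odd-degree-values f n deg 2∤n p good)) ,
  (λ 2∣n → root-mod f n deg 2∣n p good ,
    λ root → infinite-multiples f p (Good.prime good)
      (even-degree-values f n deg 1≤n separable p good root))
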